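{- If $k\ge 7$ is odd and $g=2d\ge 8$, where $d$ is an even integer, then there exists no $(k,g)$-graph with bicyclic excess $4$.
   Context: Graphs are finite and simple. A $(k,g)$-graph is a $k$-regular graph of girth $g$. For even $g=2d$ the Moore bound is $M(k,g)=2\bigl(1+(k-1)+\dots+(k-1)^{d-1}\bigr)$, and the excess of a $(k,g)$-graph of order $n$ is $n-M(k,g)$. For $k\ge 6$ and $g=2d\ge 6$, a $(k,g)$-graph $G$ of excess $4$ is bipartite of diameter $d+1$ (known theorem of Biggs and Ito). The excess graph $G(E)$ of such a graph $G$ is the graph on the vertex set of $G$ in which two vertices are adjacent if and only if their distance in $G$ is $d+1$. A $(k,g)$-graph $G$ of excess $4$ has bicyclic excess $4$ if $G(E)$ is a disjoint union of exactly two cycles. -}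

module Defs where

open import Level using (0ℓ)
open import Data.Empty using (⊥)
open import Data.Nat using (ℕ; zero; suc; _*_; _∸_; _^_; _≤_; s≤s)
import Data.Nat.Properties as ℕₚ
open import Data.Integer using (ℤ; +_; _⊖_)
open import Data.Fin using (Fin; toℕ; fromℕ<)
open import Data.Fin.Properties using (any?; all?; _≟_; toℕ<n; toℕ-fromℕ<)
open import Data.List using (length; filter; allFin; map; sum; upTo)
open import Data.Product using (Σ; ∃-syntax; _×_; _,_)
open import Data.Sum using (_⊎_; inj₁; inj₂; swap)
open import Function.Bundles using (_↔_; _⇔_; Inverse)
open import Function.Definitions using (Injective)
open import Relation.Binary using (Rel; Decidable; Symmetric)
open import Relation.Binary.PropositionalEquality using (_≡_; refl; sym; subst)
open import Relation.Nullary using (¬_; Dec; yes; no; ¬?)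
open import Relation.Nullary.Decidable using (map′; _×-dec_; _⊎-dec_)

record Graph (V : Set) : Set₁ where
  field
    Adj        : Rel V 0ℓ
    adj?       : Decidable Adj
    adj-sym    : Symmetric Adj
    adj-irrefl : ∀ {v} → ¬ Adj v v

open Graph public

infix 4 _≅_

record _≅_ {V W : Set} (G : Graph V) (H : Graph W) : Set where
  field
    bijection : V ↔ W
    adj-⇔     : ∀ u v → Adj G u v ⇔ Adj H (Inverse.to bijection u) (Inverse.to bijection v)

degree : ∀ {n} → Graph (Fin n) → Fin n → ℕ
degree {n} G u = length (filter (adj? G u) (allFin n))

Regular : ∀ {n} → ℕ → Graph (Fin n) → Set
Regular k G = ∀ u → degree G u ≡ k

infixr 5 _⊎ᴳ_

_⊎ᴳ_ : ∀ {V W} → Graph V → Graph W → Graph (V ⊎ W)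
_⊎ᴳ_ {V} {W} G H = record
  { Adj = A ; adj? = A? ; adj-sym = λ {x} {y} → A-sym {x} {y}
  ; adj-irrefl = λ {x} → A-irrefl {x} }
  where
  A : Rel (V ⊎ W) 0ℓ
  A (inj₁ u) (inj₁ v) = Adj G u v
  A (inj₁ _) (inj₂ _) = ⊥
  A (inj₂ _) (inj₁ _) = ⊥
  A (inj₂ u) (inj₂ v) = Adj H u v
  A? : Decidable A
  A? (inj₁ u) (inj₁ v) = adj? G u v
  A? (inj₁ _) (inj₂ _) = no λ ()
  A? (inj₂ _) (inj₁ _) = no λ ()
  A? (inj₂ u) (inj₂ v) = adj? H u v
  A-sym : ∀ {x y} → A x y → A y x
  A-sym {inj₁ _} {inj₁ _} = adj-sym G
  A-sym {inj₂ _} {inj₂ _} = adj-sym H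
  A-irrefl : ∀ {x} → ¬ A x x
  A-irrefl {inj₁ _} = adj-irrefl G
  A-irrefl {inj₂ _} = adj-irrefl H

-- j is the cyclic successor of i modulo n.
CyclicSucc : ∀ {n} → Rel (Fin n) 0ℓ
CyclicSucc {n} i j =
  (suc (toℕ i) ≡ toℕ j) ⊎ (suc (toℕ i) ≡ n × toℕ j ≡ 0)

cyclicSucc? : ∀ {n} → Decidable (CyclicSucc {n})
cyclicSucc? {n} i j =
  (suc (toℕ i) ℕₚ.≟ toℕ j) ⊎-dec ((suc (toℕ i) ℕₚ.≟ n) ×-dec (toℕ j ℕₚ.≟ 0))

cyclicSucc-irrefl : ∀ {n} → 3 ≤ n → {i : Fin n} → ¬ CyclicSucc i i
cyclicSucc-irrefl _ (inj₁ e) = ℕₚ.1+n≢n e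
cyclicSucc-irrefl (s≤s ()) {Fin.zero} (inj₂ (refl , _))
cyclicSucc-irrefl _ {Fin.suc _} (inj₂ (_ , ()))

cycleGraph : (n : ℕ) → 3 ≤ n → Graph (Fin n)
cycleGraph n 3≤n = record
  { Adj        = λ i j → CyclicSucc i j ⊎ CyclicSucc j i
  ; adj?       = λ i j → cyclicSucc? i j ⊎-dec cyclicSucc? j i
  ; adj-sym    = swap
  ; adj-irrefl = λ { (inj₁ s) → cyclicSucc-irrefl 3≤n s
                   ; (inj₂ s) → cyclicSucc-irrefl 3≤n s } }

-- G contains a (not necessarily induced) subgraph isomorphic to the ℓ-cycle.
HasCycle : ∀ {V} → Graph V → ℕ → Set
HasCycle {V} G ℓ =
  Σ (3 ≤ ℓ) λ 3≤ℓ → ∃[ c ]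
    (Injective _≡_ _≡_ c × (∀ i j → Adj (cycleGraph ℓ 3≤ℓ) i j → Adj G (c i) (c j)))

HasGirth : ∀ {V} → Graph V → ℕ → Set
HasGirth G g = HasCycle G g × (∀ ℓ → HasCycle G ℓ → g ≤ ℓ)

data Walk {V : Set} (G : Graph V) : V → V → ℕ → Set where
  []  : ∀ {u} → Walk G u u 0
  _∷_ : ∀ {u v w ℓ} → Adj G u v → Walk G v w ℓ → Walk G u w (suc ℓ)

-- The distance from u to v is m.  Holds for no m when u and v lie in
-- different components.
HasDistance : ∀ {V} → Graph V → V → V → ℕ → Set
HasDistance G u v m = Walk G u v m × (∀ ℓ → Walk G u v ℓ → m ≤ ℓ)

snoc : ∀ {V} {G : Graph V} {u v w ℓ} → Walk G u v ℓ → Adj G v w → Walk G u w (suc ℓ)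
snoc []      a = a ∷ []
snoc (b ∷ p) a = b ∷ snoc p a

reverse : ∀ {V} {G : Graph V} {u v ℓ} → Walk G u v ℓ → Walk G v u ℓ
reverse         []      = []
reverse {G = G} (a ∷ p) = snoc (reverse p) (adj-sym G a)

hasDistance-sym : ∀ {V} (G : Graph V) {u v m} → HasDistance G u v m → HasDistance G v u m
hasDistance-sym G (p , min) = reverse p , λ ℓ q → min ℓ (reverse q)

walk? : ∀ {n} (G : Graph (Fin n)) u v ℓ → Dec (Walk G u v ℓ)
walk? G u v zero    = map′ (λ { refl → [] }) (λ { [] → refl }) (u ≟ v)
walk? G u v (suc ℓ) =
  map′ (λ { (_ , a , p) → a ∷ p }) (λ { (a ∷ p) → _ , a , p })
       (any? λ w → adj? G u w ×-dec walk? G w v ℓ)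

hasDistance? : ∀ {n} (G : Graph (Fin n)) u v m → Dec (HasDistance G u v m)
hasDistance? G u v m =
  walk? G u v m ×-dec
  map′ (λ none ℓ p → ℕₚ.≮⇒≥ λ ℓ<m →
          none (fromℕ< ℓ<m) (subst (Walk G u v) (sym (toℕ-fromℕ< ℓ<m)) p))
       (λ min i p → ℕₚ.<⇒≱ (toℕ<n i) (min (toℕ i) p))
       (all? λ (i : Fin m) → ¬? (walk? G u v (toℕ i)))

IsKGGraph : ∀ {n} → ℕ → ℕ → Graph (Fin n) → Set
IsKGGraph k g G = Regular k G × HasGirth G g

-- The Moore bound M(k , 2d), for k ≥ 1.
mooreBound : ℕ → ℕ → ℕ
mooreBound k d = 2 * sum (map (λ i → (k ∸ 1) ^ i) (upTo d))

-- The excess, relative to the parameters (k , 2d), of a graph of order n;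
-- _⊖_ is the integer difference of two naturals.
excess : ∀ {n} → ℕ → ℕ → Graph (Fin n) → ℤ
excess {n} k d _ = n ⊖ mooreBound k d

excessGraph : ∀ {n} → ℕ → Graph (Fin n) → Graph (Fin n)
excessGraph d G = record
  { Adj        = λ u v → HasDistance G u v (suc d)
  ; adj?       = λ u v → hasDistance? G u v (suc d)
  ; adj-sym    = hasDistance-sym G
  ; adj-irrefl = λ { (_ , min) → ℕₚ.n≮0 (min 0 []) } }

IsUnionOfTwoCycles : ∀ {V} → Graph V → Set
IsUnionOfTwoCycles H =
  ∃[ a ] ∃[ b ] Σ (3 ≤ a) λ 3≤a → Σ (3 ≤ b) λ 3≤b →
    H ≅ (cycleGraph a 3≤a ⊎ᴳ cycleGraph b 3≤b)

-- G is a (k , 2d)-graph with bicyclic excess 4.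
record HasBicyclicExcess4 {n} (k d : ℕ) (G : Graph (Fin n)) : Set where
  field
    isKGGraph : IsKGGraph k (2 * d) G
    excess≡4  : excess k d G ≡ + 4
    bicyclic  : IsUnionOfTwoCycles (excessGraph d G)

{-# OPTIONS --safe #-}

-- Write A for the adjacency matrix of G, E for that of its excess graph, J for the all-ones
-- matrix and B for the matrix marking the pairs at odd distance.  By the girth hypothesis the
-- pairs at odd distance less than d are marked by H(A), where H = H_{d−1} is given by H₀ = 1,
-- H₁ = x and H_{i+2} = x H_{i+1} − (k−1) H_i.  Counting vertices and edges by their distance
-- from a vertex, with exactly two vertices at distance d + 1, shows that the diameter is d + 1
-- and that G is bipartite.  Hence B = H(A) + E and AB = BA = k(J − B).
--
-- Thus A preserves the 2-eigenspace of E, spanned by the indicators of the two cycles: if h is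
-- the indicator of the first one, then Ah = θh + q for integers θ and q.  Applying A to
-- Bh = (2 + H(θ))h + c and using that h is not constant gives (2 + H(θ))(θ + k) = 0.  Since k − 1
-- is even, H(θ) is odd for odd θ and divisible by 4 for even θ, so θ = −k and every edge of G
-- joins the two cycles.  But an edge of E lies within a cycle while its ends are joined by a
-- walk of odd length d + 1.
module Submission where

open import Data.Empty using (⊥; ⊥-elim)
open import Data.Fin using (Fin; toℕ; fromℕ; fromℕ<; inject₁) renaming (suc to fsuc; zero to fzero)
open import Data.Fin.Induction using (<-weakInduction)
open import Data.Fin.Properties using (any?; _≟_; suc-injective; toℕ<n; toℕ-injective; toℕ-fromℕ; toℕ-fromℕ<; toℕ-inject₁)
open import Data.Product using (Σ; ∃-syntax; _×_; _,_; proj₁; proj₂)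
open import Data.Sum using (_⊎_; inj₁; inj₂; [_,_]′; reduce)
open import Data.Sum.Properties using (inj₁-injective; inj₂-injective)
open import Function using (_∘_; id)
open import Function.Bundles using (Inverse; Equivalence)
open import Relation.Binary.PropositionalEquality
open import Relation.Nullary using (¬_; Dec; yes; no; contradiction; from-no)
open import Relation.Unary using (Pred; Decidable)
open import Defs
import Algebra.Properties.Semiring.Sum as SemiringSum
import Data.Nat as ℕ
import Data.Nat.Divisibility as ℕᵈ
import Data.Nat.Properties as ℕₚ

-- The 2-eigenvectors of a 2-regular graph are the functions constant on its cycles, so with two
-- cycles they form, modulo constants, a line. On that line A has a single eigenvalue θ, and θ is an
-- integer because h takes only the values 0 and 1. This integrality is what lets a parity argument
-- on H(θ) decide. All computations stay in the integers; instead of diagonalising E, the vanishing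
-- of a Dirichlet energy shows that its 2-eigenvectors are constant along edges. Connectedness is
-- not assumed, so distances are capped at d + 2; the capped value collects all farther and all
-- unreachable vertices, and an edge count shows that there are none. The numerical hypotheses enter
-- as follows. From k ≥ 7 comes 2(k - 3) > k, which excludes edges inside level d. Evenness of d
-- makes both d - 1 and d + 1 odd. From d ≥ 4 the index of H is at least 3, where both terms of the
-- recurrence are divisible by 4 for even θ.

module Walks where

  open import Data.Nat hiding (_≟_)
  open import Data.Nat.Properties hiding (_≟_; suc-injective)

  -- Non-backtracking walks and cycles.

  module _ {n} (G : Graph (Fin n)) where

    private V = Fin n

    -- The walk is a total function of which only the values up to `ℓ` matter; prepending or
    -- dropping a vertex is then a shift of the index.
    record NonBacktracking (c : ℕ → V) (ℓ : ℕ) : Set where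
      field
        step   : ∀ i → i < ℓ → Adj G (c i) (c (suc i))
        noBack : ∀ i → suc i < ℓ → c i ≢ c (2 + i)

    open NonBacktracking

    infixr 5 _◂_

    _◂_ : V → (ℕ → V) → ℕ → V
    (x ◂ c) zero    = x
    (x ◂ c) (suc i) = c i

    ◂-nonBacktracking : ∀ {x c ℓ} → Adj G x (c 0) → (0 < ℓ → x ≢ c 1) →
      NonBacktracking c ℓ → NonBacktracking (x ◂ c) (suc ℓ)
    ◂-nonBacktracking a x≢ nb = record
      { step   = λ { zero _ → a ; (suc i) (s≤s i<) → step nb i i< }
      ; noBack = λ { zero (s≤s 0<) → x≢ 0< ; (suc i) (s≤s i<) → noBack nb i i< } }

    tail-nonBacktracking : ∀ {c ℓ} → NonBacktracking c (suc ℓ) → NonBacktracking (c ∘ suc) ℓ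
    tail-nonBacktracking nb = record
      { step   = λ i i< → step nb (suc i) (s≤s i<)
      ; noBack = λ i i< → noBack nb (suc i) (s≤s i<) }

    InjectiveUpTo : ℕ → (ℕ → V) → Set
    InjectiveUpTo ℓ c = ∀ i j → i ≤ ℓ → j ≤ ℓ → c i ≡ c j → i ≡ j

    -- The cycle runs through `c 1`, ..., `c (suc m)`, and the first edge of the walk closes it.
    -- Lengths 1 and 2 are excluded by irreflexivity and by `noBack`.
    closed⇒hasCycle : ∀ {c ℓ} m → m ≤ ℓ → NonBacktracking c (suc ℓ) →
      InjectiveUpTo ℓ (c ∘ suc) → c 0 ≡ c (suc m) → HasCycle G (suc m)
    closed⇒hasCycle zero m≤ nb _ eq =
      ⊥-elim (adj-irrefl G (subst (Adj G _) (sym eq) (step nb 0 (s≤s z≤n))))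
    closed⇒hasCycle (suc zero) m≤ nb _ eq = ⊥-elim (noBack nb 0 (s≤s m≤) eq)
    closed⇒hasCycle {c} {ℓ} m@(suc (suc _)) m≤ nb inj eq =
      s≤s (s≤s (s≤s z≤n)) , c ∘ suc ∘ toℕ ,
      (λ {x} {y} e → toℕ-injective (inj _ _ (bound x) (bound y) e)) , edge
      where
      bound : (x : Fin (suc m)) → toℕ x ≤ ℓ
      bound x = ≤-trans (s≤s⁻¹ (toℕ<n x)) m≤
      succEdge : ∀ i j → CyclicSucc i j → Adj G (c (suc (toℕ i))) (c (suc (toℕ j)))
      succEdge i j (inj₁ e) = subst (λ t → Adj G _ (c (suc t))) e
        (step nb _ (s≤s (subst (_≤ ℓ) (sym e) (bound j))))
      succEdge i j (inj₂ (e , f)) = subst₂ (λ s t → Adj G s (c (suc t)))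
        (trans eq (cong c (sym e))) (sym f) (step nb 0 (s≤s z≤n))
      edge : ∀ i j → CyclicSucc i j ⊎ CyclicSucc j i → Adj G (c (suc (toℕ i))) (c (suc (toℕ j)))
      edge i j (inj₁ s) = succEdge i j s
      edge i j (inj₂ s) = adj-sym G (succEdge j i s)

    -- Peel off the first vertex: once the tail is injective, only the first vertex can be repeated,
    -- and its recurrence closes a cycle.
    injective-or-cycle : ∀ ℓ c → NonBacktracking c ℓ →
      InjectiveUpTo ℓ c ⊎ ∃[ m ] (HasCycle G m × m ≤ ℓ)
    injective-or-cycle zero c nb = inj₁ λ { _ _ z≤n z≤n _ → refl }
    injective-or-cycle (suc ℓ) c nb with injective-or-cycle ℓ (c ∘ suc) (tail-nonBacktracking nb)
    ... | inj₂ (m , cyc , m≤) = inj₂ (m , cyc , m≤n⇒m≤1+n m≤)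
    ... | inj₁ inj with any? (λ (i : Fin (suc ℓ)) → c 0 ≟ c (suc (toℕ i)))
    ...   | yes (i , eq) =
      inj₂ (_ , closed⇒hasCycle (toℕ i) (s≤s⁻¹ (toℕ<n i)) nb inj eq , toℕ<n i)
    ...   | no none = inj₁ ext
      where
      new : ∀ j → j ≤ ℓ → c 0 ≢ c (suc j)
      new j j≤ e = none (fromℕ< (s≤s j≤) ,
        trans e (cong (c ∘ suc) (sym (toℕ-fromℕ< (s≤s j≤)))))
      ext : InjectiveUpTo (suc ℓ) c
      ext zero    zero    _ _ _ = refl
      ext zero    (suc j) _ (s≤s j≤) e = ⊥-elim (new j j≤ e)
      ext (suc i) zero    (s≤s i≤) _ e = ⊥-elim (new i i≤ (sym e))
      ext (suc i) (suc j) (s≤s i≤) (s≤s j≤) e = cong suc (inj i j i≤ j≤ e)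

    girth≤closed : ∀ {g c ℓ} → HasGirth G g → NonBacktracking c ℓ → 0 < ℓ → c 0 ≡ c ℓ → g ≤ ℓ
    girth≤closed {ℓ = ℓ} (_ , shortest) nb 0<ℓ eq with injective-or-cycle ℓ _ nb
    ... | inj₁ inj = contradiction (inj 0 ℓ z≤n ≤-refl eq) (<⇒≢ 0<ℓ)
    ... | inj₂ (m , cyc , m≤) = ≤-trans (shortest m cyc) m≤

    -- The distance from u to v, or N if there is no walk shorter than N.
    record TruncatedDistance (N : ℕ) (u v : V) : Set where
      field
        value  : ℕ
        value≤ : value ≤ N
        lower  : ∀ {ℓ} → Walk G u v ℓ → value ≤ ℓ
        attain : value < N → Walk G u v value

    truncatedDistance : ∀ N u v → TruncatedDistance N u v
    truncatedDistance zero u v = record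
      { value = 0 ; value≤ = z≤n ; lower = λ _ → z≤n ; attain = λ () }
    truncatedDistance (suc N) u v with truncatedDistance N u v
    ... | t with TruncatedDistance.value t <? N
    ...   | yes lt = record
      { value = TruncatedDistance.value t ; value≤ = m≤n⇒m≤1+n (TruncatedDistance.value≤ t)
      ; lower = TruncatedDistance.lower t ; attain = λ _ → TruncatedDistance.attain t lt }
    ...   | no ge with walk? G u v N
    ...     | yes p = record
      { value = N ; value≤ = n≤1+n N ; attain = λ _ → p
      ; lower = λ q → ≤-trans (≮⇒≥ ge) (TruncatedDistance.lower t q) }
    ...     | no ¬p = record
      { value = suc N ; value≤ = ≤-refl ; attain = λ lt → contradiction lt (<-irrefl refl)
      ; lower = λ q → ≤∧≢⇒< (≤-trans (≮⇒≥ ge) (TruncatedDistance.lower t q))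
                            (λ { refl → ¬p q }) }

    -- Truncated distances and geodesics.

    module Distance (N : ℕ) (0<N : 0 < N) where

      private module T u v = TruncatedDistance (truncatedDistance N u v)

      opaque
        dist : V → V → ℕ
        dist = T.value

        dist≤N : ∀ u v → dist u v ≤ N
        dist≤N = T.value≤

        dist-self : ∀ u → dist u u ≡ 0
        dist-self u = n≤0⇒n≡0 (T.lower u u [])

        dist≡0⇒≡ : ∀ {u v} → dist u v ≡ 0 → u ≡ v
        dist≡0⇒≡ {u} {v} e
          with subst (Walk G u v) e (T.attain u v (subst (_< N) (sym e) 0<N))
        ... | [] = refl

        dist-step : ∀ {u w} v → Adj G u w → dist u v ≤ suc (dist w v)
        dist-step {u} {w} v a with m≤n⇒m<n∨m≡n (dist≤N w v)
        ... | inj₁ lt = T.lower u v (a ∷ T.attain w v lt)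
        ... | inj₂ eq = ≤-trans (dist≤N u v) (≤-trans (≤-reflexive (sym eq)) (n≤1+n _))

        dist-sym : ∀ u v → dist u v ≡ dist v u
        dist-sym u v = ≤-antisym (one-way u v) (one-way v u)
          where
          one-way : ∀ u v → dist u v ≤ dist v u
          one-way u v with m≤n⇒m<n∨m≡n (dist≤N v u)
          ... | inj₁ lt = T.lower u v (reverse (T.attain v u lt))
          ... | inj₂ eq = ≤-trans (dist≤N u v) (≤-reflexive (sym eq))

        -- Only a distance below the cap `N` is known to be realised by a walk, hence the bound on
        -- `suc j`.
        parent : ∀ {u v j} → dist u v ≡ suc j → suc j < N → ∃[ w ] (Adj G u w × dist w v ≡ j)
        parent {u} {v} {j} e lt
          with subst (Walk G u v) e (T.attain u v (subst (_< N) (sym e) lt))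
        ... | _∷_ {v = w} a p = w , a ,
          ≤-antisym (T.lower w v p) (s≤s⁻¹ (subst (_≤ suc (dist w v)) e (dist-step v a)))

        dist⇒hasDistance : ∀ {u v m} → m < N → dist u v ≡ m → HasDistance G u v m
        dist⇒hasDistance {u} {v} lt refl = T.attain u v lt , λ _ → T.lower u v

        hasDistance⇒dist : ∀ {u v m} → m < N → HasDistance G u v m → dist u v ≡ m
        hasDistance⇒dist {u} {v} lt (p , shortest) = ≤-antisym (T.lower u v p)
          (shortest _ (T.attain u v (≤-<-trans (T.lower u v p) lt)))

      adj-levels : ∀ {u w} v → Adj G u w → ∀ {j} → dist u v ≡ suc j →
        (dist w v ≡ j) ⊎ (dist w v ≡ suc j) ⊎ (dist w v ≡ suc (suc j))
      adj-levels {u} {w} v a {j} e with m≤n⇒m<n∨m≡n (subst (dist w v ≤_) (cong suc e) (dist-step v (adj-sym G a)))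
      ... | inj₂ eq = inj₂ (inj₂ eq)
      ... | inj₁ lt with m≤n⇒m<n∨m≡n (s≤s⁻¹ lt)
      ...   | inj₂ eq = inj₂ (inj₁ eq)
      ...   | inj₁ lt′ = inj₁ (≤-antisym (s≤s⁻¹ lt′) (s≤s⁻¹ (subst (_≤ suc (dist w v)) e (dist-step v a))))

      -- The last clause locates the second vertex one step nearer to `v`. Comparing distances to
      -- `v` then shows that a prepended vertex causes no backtracking.
      geodesic : ∀ j {u v} → dist u v ≡ j → j < N →
        ∃[ c ] (NonBacktracking c j × c 0 ≡ u × c j ≡ v × (∀ {i} → j ≡ suc i → dist (c 1) v ≡ i))
      geodesic zero {u} e _ = (λ _ → u) ,
        record { step = λ _ () ; noBack = λ _ () } , refl , dist≡0⇒≡ e , λ ()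
      geodesic (suc j) {u} {v} e lt with parent e lt
      ... | w , a , e′ with geodesic j e′ (<-trans (n<1+n j) lt)
      ...   | c , nb , refl , cj , next = u ◂ c , ◂-nonBacktracking a fresh nb , refl , cj , λ { refl → e′ }
        where
        fresh : 0 < j → u ≢ c 1
        fresh (s≤s {n = i} _) refl = contradiction (trans (sym e) (next refl)) λ e″ → m≢1+n+m i (sym e″)

      -- Girth bounds from coinciding distances.

      module Girth {g} (girth : HasGirth G g) where

        -- Prolongs a walk ending in v backwards along a geodesic, until it closes up at v.
        closeUp : ∀ j {c ℓ v} → NonBacktracking c ℓ → dist (c 0) v ≡ j → j < N → c ℓ ≡ v → 0 < ℓ →
          (∀ x → suc (dist x v) ≡ j → x ≢ c 1) → g ≤ j + ℓ
        closeUp zero nb e _ end 0<ℓ _ = girth≤closed girth nb 0<ℓ (trans (dist≡0⇒≡ e) (sym end))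
        closeUp (suc j) {c} {ℓ} nb e lt end 0<ℓ fresh with parent e lt
        ... | x , a , e′ = subst (g ≤_) (+-suc j ℓ)
          (closeUp j (◂-nonBacktracking (adj-sym G a) (λ _ → fresh x (cong suc e′)) nb)
            e′ (<-trans (n<1+n j) lt) end (s≤s z≤n)
            λ { y ey refl → m≢1+n+m j (trans (sym ey) (cong suc e)) })

        -- Geodesics from `w` and from `u` to `v`, joined by the edge, form a closed walk of length
        -- 2j + 1. It does not backtrack, as the vertices next to the edge are nearer to `v` than
        -- its ends.
        level-edge⇒girth≤ : ∀ {u w v j} → Adj G u w → dist u v ≡ j → dist w v ≡ j → j < N →
          g ≤ j + suc j
        level-edge⇒girth≤ {u} {w} {v} {j} a eu ew lt with geodesic j ew lt
        ... | c , nb , refl , cj , next =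
          closeUp j (◂-nonBacktracking a fresh nb) eu lt cj (s≤s z≤n)
            λ { x ex refl → 1+n≢n (trans ex (sym ew)) }
          where
          fresh : 0 < j → u ≢ c 1
          fresh (s≤s _) refl = 1+n≢n (trans (sym eu) (next refl))

        -- Two geodesics from `u` to `v` with different first steps form a closed walk of length 2j
        -- + 2.
        two-parents⇒girth≤ : ∀ {u w w′ v j} → Adj G u w → Adj G u w′ → w ≢ w′ →
          dist u v ≡ suc j → dist w v ≡ j → dist w′ v ≡ j → suc j < N → g ≤ j + (2 + j)
        two-parents⇒girth≤ {u} {w} {w′} {v} {j} a a′ w≢ eu ew ew′ lt with geodesic j ew′ (<-trans (n<1+n j) lt)
        ... | c , nb , refl , cj , next =
          closeUp j (◂-nonBacktracking (adj-sym G a) (λ _ → w≢) (◂-nonBacktracking a′ fresh nb))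
            ew (<-trans (n<1+n j) lt) cj (s≤s z≤n)
            λ { x ex refl → m≢1+n+m j (trans (sym ex) (cong suc eu)) }
          where
          fresh : 0 < j → u ≢ c 1
          fresh (s≤s {n = i} _) refl = m≢1+n+m i (trans (sym (next refl)) eu)

module Excess where

  open import Data.Integer hiding (suc; _≟_; ∣_∣)
  open import Data.Integer.DivMod using (_%ℕ_; _/ℕ_; n%ℕd<d; a≡a%ℕn+[a/ℕn]*n)
  open import Data.Integer.Divisibility.Signed
    using (_∣_; divides; ∣⇒∣ᵤ; ∣m∣n⇒∣m+n; ∣m∣n⇒∣m-n; ∣m⇒∣m*n)
  open import Data.Integer.Properties hiding (_≟_)
  open import Data.Integer.Tactic.RingSolver using (solve-∀)
  open import Data.List using (length; filter; tabulate; applyUpTo; upTo; map)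
  open import Data.Nat using (ℕ; zero; suc; s≤s; z≤n)
  open import Data.Nat.ListAction using (sum)
  open Walks

  private module Sum = SemiringSum +-*-semiring

  -- Integer indicators and finite sums.

  𝟙 : ∀ {p} {P : Set p} → Dec P → ℤ
  𝟙 (yes _) = 1ℤ
  𝟙 (no _)  = 0ℤ

  𝟙-yes : ∀ {p} {P : Set p} (P? : Dec P) → P → 𝟙 P? ≡ 1ℤ
  𝟙-yes (yes _) _ = refl
  𝟙-yes (no ¬p) p = contradiction p ¬p

  𝟙-no : ∀ {p} {P : Set p} (P? : Dec P) → ¬ P → 𝟙 P? ≡ 0ℤ
  𝟙-no (yes p) ¬p = contradiction p ¬p
  𝟙-no (no _)  _  = refl

  𝟙-cong : ∀ {p q} {P : Set p} {Q : Set q} (P? : Dec P) (Q? : Dec Q) → (P → Q) → (Q → P) → 𝟙 P? ≡ 𝟙 Q?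
  𝟙-cong (yes p) Q? f g = sym (𝟙-yes Q? (f p))
  𝟙-cong (no ¬p) Q? f g = sym (𝟙-no Q? (¬p ∘ g))

  0≤𝟙 : ∀ {p} {P : Set p} (P? : Dec P) → 0ℤ ≤ 𝟙 P?
  0≤𝟙 (yes _) = +≤+ z≤n
  0≤𝟙 (no _)  = ≤-refl

  0≤* : ∀ {i j} → 0ℤ ≤ i → 0ℤ ≤ j → 0ℤ ≤ i * j
  0≤* {i} {j} p q = subst (_≤ i * j) (*-zeroʳ i)
    (*-monoˡ-≤-nonNeg i {{nonNegative p}} q)

  0≤square : ∀ i → 0ℤ ≤ i * i
  0≤square (+ n)      = 0≤* {+ n} {+ n} (+≤+ z≤n) (+≤+ z≤n)
  0≤square (-[1+ n ]) = +≤+ z≤n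

  opaque
    ∑ : ∀ {n} → (Fin n → ℤ) → ℤ
    ∑ = Sum.sum

    ∑-cong : ∀ {n} {f g : Fin n → ℤ} → (∀ i → f i ≡ g i) → ∑ f ≡ ∑ g
    ∑-cong = Sum.sum-cong-≗

    ∑-distrib-+ : ∀ {n} (f g : Fin n → ℤ) → ∑ (λ i → f i + g i) ≡ ∑ f + ∑ g
    ∑-distrib-+ = Sum.∑-distrib-+

    ∑-comm : ∀ {m n} (f : Fin m → Fin n → ℤ) → ∑ (λ i → ∑ (f i)) ≡ ∑ (λ j → ∑ (λ i → f i j))
    ∑-comm = Sum.∑-comm

    sum-mono-≤ : ∀ {n} {f g : Fin n → ℤ} → (∀ i → f i ≤ g i) → ∑ f ≤ ∑ g
    sum-mono-≤ {zero}  h = ≤-refl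
    sum-mono-≤ {suc n} h = +-mono-≤ (h fzero) (sum-mono-≤ (h ∘ fsuc))

    sum-zero : ∀ n → ∑ {n} (λ _ → 0ℤ) ≡ 0ℤ
    sum-zero zero    = refl
    sum-zero (suc n) = trans (+-identityˡ _) (sum-zero n)

    sum-one : ∀ n → ∑ {n} (λ _ → 1ℤ) ≡ + n
    sum-one zero    = refl
    sum-one (suc n) = cong (_+_ 1ℤ) (sum-one n)

    0≤sum : ∀ {n} {f : Fin n → ℤ} → (∀ i → 0ℤ ≤ f i) → 0ℤ ≤ ∑ f
    0≤sum {n} {f} h = subst (_≤ ∑ f) (sum-zero n) (sum-mono-≤ h)

    term≤sum : ∀ {n} {f : Fin n → ℤ} → (∀ i → 0ℤ ≤ f i) → ∀ i → f i ≤ ∑ f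
    term≤sum {f = f} h fzero =
      subst (_≤ ∑ f) (+-identityʳ _) (+-monoʳ-≤ (f fzero) (0≤sum (h ∘ fsuc)))
    term≤sum {f = f} h (fsuc i) =
      subst (_≤ ∑ f) (+-identityˡ _) (+-mono-≤ (h fzero) (term≤sum (h ∘ fsuc) i))

    sum≡0⇒term≡0 : ∀ {n} {f : Fin n → ℤ} → (∀ i → 0ℤ ≤ f i) → ∑ f ≡ 0ℤ → ∀ i → f i ≡ 0ℤ
    sum≡0⇒term≡0 h e i = ≤-antisym (subst (_ ≤_) e (term≤sum h i)) (h i)

    sum-at : ∀ {n} (p : Fin n) (f : Fin n → ℤ) → ∑ (λ w → 𝟙 (p ≟ w) * f w) ≡ f p
    sum-at {suc n} fzero f = begin
      1ℤ * f fzero + ∑ (λ w → 0ℤ * f (fsuc w)) ≡⟨ cong₂ _+_ (*-identityˡ (f fzero)) (sum-zero n) ⟩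
      f fzero + 0ℤ                               ≡⟨ +-identityʳ _ ⟩
      f fzero                                    ∎
      where open ≡-Reasoning
    sum-at {suc n} (fsuc p) f = begin
      0ℤ + ∑ (λ w → 𝟙 (fsuc p ≟ fsuc w) * f (fsuc w)) ≡⟨ +-identityˡ _ ⟩
      ∑ (λ w → 𝟙 (fsuc p ≟ fsuc w) * f (fsuc w))      ≡⟨ ∑-cong (λ w → cong (_* f (fsuc w))
          (𝟙-cong (fsuc p ≟ fsuc w) (p ≟ w) suc-injective (cong fsuc))) ⟩
      ∑ (λ w → 𝟙 (p ≟ w) * f (fsuc w))                ≡⟨ sum-at p (f ∘ fsuc) ⟩
      f (fsuc p)                                        ∎
      where open ≡-Reasoning

    sum-*ˡ : ∀ {n} (c : ℤ) (f : Fin n → ℤ) → ∑ (λ i → c * f i) ≡ c * ∑ f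
    sum-*ˡ c f = sym (Sum.*-distribˡ-sum c f)

    sum-*ʳ : ∀ {n} (c : ℤ) (f : Fin n → ℤ) → ∑ (λ i → f i * c) ≡ ∑ f * c
    sum-*ʳ c f = trans (∑-cong λ i → *-comm (f i) c) (trans (sum-*ˡ c f) (*-comm c _))

    +length-filter : ∀ {n a} {A : Set a} {P : Pred A a} (P? : Decidable P) (f : Fin n → A) →
      + length (filter P? (tabulate f)) ≡ ∑ (λ i → 𝟙 (P? (f i)))
    +length-filter {zero}  P? f = refl
    +length-filter {suc n} P? f with P? (f fzero)
    ... | yes _ = cong (_+_ 1ℤ) (+length-filter P? (f ∘ fsuc))
    ... | no _  = trans (+length-filter P? (f ∘ fsuc)) (sym (+-identityˡ _))

  -- The adjacency operator and edge counts.

  module Neighbours {n} (H : Graph (Fin n)) where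

    private
      V = Fin n

      A : V → V → ℤ
      A u w = 𝟙 (adj? H u w)

      A-sym : ∀ u w → A u w ≡ A w u
      A-sym u w = 𝟙-cong (adj? H u w) (adj? H w u) (adj-sym H) (adj-sym H)

    opaque
      -- `nbrSum f` is the adjacency matrix applied to the vector `f`.
      nbrSum : (V → ℤ) → V → ℤ
      nbrSum f u = ∑ (λ w → 𝟙 (adj? H u w) * f w)

      nbrSum-def : ∀ f u → nbrSum f u ≡ ∑ (λ w → 𝟙 (adj? H u w) * f w)
      nbrSum-def f u = refl

      nbrSum-cong : ∀ {f g u} → (∀ w → Adj H u w → f w ≡ g w) → nbrSum f u ≡ nbrSum g u
      nbrSum-cong {f} {g} {u} h = ∑-cong λ w → at w
        where
        at : ∀ w → A u w * f w ≡ A u w * g w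
        at w with adj? H u w
        ... | yes a = cong (1ℤ *_) (h w a)
        ... | no _  = refl

      nbrSum-mono : ∀ {f g u} → (∀ w → Adj H u w → f w ≤ g w) → nbrSum f u ≤ nbrSum g u
      nbrSum-mono {f} {g} {u} h = sum-mono-≤ λ w → at w
        where
        at : ∀ w → A u w * f w ≤ A u w * g w
        at w with adj? H u w
        ... | yes a = *-monoˡ-≤-nonNeg 1ℤ (h w a)
        ... | no _  = ≤-refl

      0≤nbrSum : ∀ {f u} → (∀ w → 0ℤ ≤ f w) → 0ℤ ≤ nbrSum f u
      0≤nbrSum {u = u} h = 0≤sum λ w → 0≤* (0≤𝟙 (adj? H u w)) (h w)

      term≤nbrSum : ∀ {f u w} → (∀ w → 0ℤ ≤ f w) → Adj H u w → f w ≤ nbrSum f u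
      term≤nbrSum {f} {u} {w} h a = subst (_≤ nbrSum f u)
        (trans (cong (_* f w) (𝟙-yes (adj? H u w) a)) (*-identityˡ _))
        (term≤sum (λ w → 0≤* (0≤𝟙 (adj? H u w)) (h w)) w)

      nbrSum≤sum : ∀ {f u} → (∀ w → 0ℤ ≤ f w) → nbrSum f u ≤ ∑ f
      nbrSum≤sum {f} {u} h = sum-mono-≤ λ w → at w
        where
        at : ∀ w → A u w * f w ≤ f w
        at w with adj? H u w
        ... | yes a = ≤-reflexive (*-identityˡ _)
        ... | no _  = h w

      nbrSum-+ : ∀ f g u → nbrSum (λ w → f w + g w) u ≡ nbrSum f u + nbrSum g u
      nbrSum-+ f g u = trans (∑-cong λ w → *-distribˡ-+ (A u w) (f w) (g w))
        (∑-distrib-+ (λ w → A u w * f w) (λ w → A u w * g w))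

      nbrSum-* : ∀ c f u → nbrSum (λ w → c * f w) u ≡ c * nbrSum f u
      nbrSum-* c f u = trans (∑-cong λ w → swap (A u w) c (f w)) (sum-*ˡ c λ w → A u w * f w)
        where
        swap : ∀ a c x → a * (c * x) ≡ c * (a * x)
        swap = solve-∀

      nbrSum-- : ∀ f g u → nbrSum (λ w → f w - g w) u ≡ nbrSum f u - nbrSum g u
      nbrSum-- f g u = begin
        nbrSum (λ w → f w - g w) u                ≡⟨ nbrSum-cong (λ w _ → minus (f w) (g w)) ⟩
        nbrSum (λ w → f w + -1ℤ * g w) u          ≡⟨ nbrSum-+ f (λ w → -1ℤ * g w) u ⟩
        nbrSum f u + nbrSum (λ w → -1ℤ * g w) u   ≡⟨ cong (_+_ (nbrSum f u)) (nbrSum-* -1ℤ g u) ⟩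
        nbrSum f u + -1ℤ * nbrSum g u             ≡⟨ minus (nbrSum f u) (nbrSum g u) ⟨
        nbrSum f u - nbrSum g u                   ∎
        where
        open ≡-Reasoning
        minus : ∀ a b → a - b ≡ a + -1ℤ * b
        minus = solve-∀

      nbrSum-at : ∀ {p u} c → Adj H u p → nbrSum (λ w → 𝟙 (p ≟ w) * c) u ≡ c
      nbrSum-at {p} {u} c a = begin
        nbrSum (λ w → 𝟙 (p ≟ w) * c) u      ≡⟨ ∑-cong (λ w → swap (A u w) (𝟙 (p ≟ w)) c) ⟩
        ∑ (λ w → 𝟙 (p ≟ w) * (A u w * c)) ≡⟨ sum-at p (λ w → A u w * c) ⟩
        A u p * c                           ≡⟨ cong (_* c) (𝟙-yes (adj? H u p) a) ⟩
        1ℤ * c                              ≡⟨ *-identityˡ c ⟩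
        c                                   ∎
        where
        open ≡-Reasoning
        swap : ∀ a b c → a * (b * c) ≡ b * (a * c)
        swap = solve-∀

      -- Associativity of the matrix product: the adjacency matrix times `F` times the vector `f`.
      nbrSum-linear : ∀ {m} (F : V → Fin m → ℤ) (f : Fin m → ℤ) u →
        nbrSum (λ w → ∑ (λ v → F w v * f v)) u ≡ ∑ (λ v → nbrSum (λ w → F w v) u * f v)
      nbrSum-linear F f u = begin
        ∑ (λ w → A u w * ∑ (λ v → F w v * f v))   ≡⟨ ∑-cong (λ w → sym (sum-*ˡ (A u w) λ v → F w v * f v)) ⟩
        ∑ (λ w → ∑ (λ v → A u w * (F w v * f v))) ≡⟨ ∑-comm (λ w v → A u w * (F w v * f v)) ⟩
        ∑ (λ v → ∑ (λ w → A u w * (F w v * f v))) ≡⟨ ∑-cong (λ v → ∑-cong λ w → sym (*-assoc (A u w) (F w v) (f v))) ⟩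
        ∑ (λ v → ∑ (λ w → A u w * F w v * f v))   ≡⟨ ∑-cong (λ v → sum-*ʳ (f v) (λ w → A u w * F w v)) ⟩
        ∑ (λ v → nbrSum (λ w → F w v) u * f v)      ∎
        where open ≡-Reasoning

      -- The bilinear form of the adjacency matrix. On indicators of two sets it counts the ordered
      -- adjacent pairs with first vertex in one and second vertex in the other.
      edgeSum : (V → ℤ) → (V → ℤ) → ℤ
      edgeSum f g = ∑ (λ u → f u * nbrSum g u)

      edgeSum-def : ∀ f g → edgeSum f g ≡ ∑ (λ u → f u * nbrSum g u)
      edgeSum-def f g = refl

      0≤edgeSum : ∀ {f g} → (∀ w → 0ℤ ≤ f w) → (∀ w → 0ℤ ≤ g w) → 0ℤ ≤ edgeSum f g
      0≤edgeSum h h′ = 0≤sum λ u → 0≤* (h u) (0≤nbrSum h′)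

      edgeSum-sym : ∀ f g → edgeSum f g ≡ edgeSum g f
      edgeSum-sym f g = begin
        ∑ (λ u → f u * ∑ (λ w → A u w * g w))   ≡⟨ ∑-cong (λ u → sym (sum-*ˡ (f u) λ w → A u w * g w)) ⟩
        ∑ (λ u → ∑ (λ w → f u * (A u w * g w))) ≡⟨ ∑-comm (λ u w → f u * (A u w * g w)) ⟩
        ∑ (λ w → ∑ (λ u → f u * (A u w * g w))) ≡⟨ ∑-cong (λ w → ∑-cong λ u →
            trans (cong (λ a → f u * (a * g w)) (A-sym u w)) (swap (f u) (A w u) (g w))) ⟩
        ∑ (λ w → ∑ (λ u → g w * (A w u * f u))) ≡⟨ ∑-cong (λ w → sum-*ˡ (g w) λ u → A w u * f u) ⟩
        ∑ (λ w → g w * ∑ (λ u → A w u * f u))   ∎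
        where
        open ≡-Reasoning
        swap : ∀ x a y → x * (a * y) ≡ y * (a * x)
        swap = solve-∀

      nbrSum+self≤sum : ∀ {f} u → (∀ w → 0ℤ ≤ f w) → nbrSum f u + f u ≤ ∑ f
      nbrSum+self≤sum {f} u h = begin
        nbrSum f u + f u                           ≡⟨ cong (_+_ (nbrSum f u)) (sum-at u f) ⟨
        nbrSum f u + ∑ (λ w → 𝟙 (u ≟ w) * f w)   ≡⟨ ∑-distrib-+ (λ w → A u w * f w) (λ w → 𝟙 (u ≟ w) * f w) ⟨
        ∑ (λ w → A u w * f w + 𝟙 (u ≟ w) * f w)  ≤⟨ sum-mono-≤ at ⟩
        ∑ f                                      ∎
        where
        open ≤-Reasoning
        at : ∀ w → A u w * f w + 𝟙 (u ≟ w) * f w ≤ f w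
        at w with u ≟ w | adj? H u w
        ... | yes refl | yes a = ⊥-elim (adj-irrefl H a)
        ... | yes refl | no _  = ≤-reflexive (trans (+-identityˡ _) (*-identityˡ _))
        ... | no _     | yes _ = ≤-reflexive (trans (+-identityʳ _) (*-identityˡ _))
        ... | no _     | no _  = h w

      edgeSum≤sum*sum : ∀ {f g} → (∀ w → 0ℤ ≤ f w) → (∀ w → 0ℤ ≤ g w) → edgeSum f g ≤ ∑ f * ∑ g
      edgeSum≤sum*sum {f} {g} hf hg = subst (edgeSum f g ≤_) (sum-*ʳ (∑ g) f)
        (sum-mono-≤ λ u → *-monoˡ-≤-nonNeg (f u) {{nonNegative (hf u)}} (nbrSum≤sum hg))

    module Indicator {f : V → ℤ} (0≤f : ∀ w → 0ℤ ≤ f w) (idem : ∀ w → f w * f w ≡ f w) where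

      opaque
        unfolding nbrSum

        -- In a set of s vertices each vertex has at most s - 1 neighbours, since it is not adjacent
        -- to itself.
        edgeSum-self≤ : edgeSum f f ≤ ∑ f * ∑ f - ∑ f
        edgeSum-self≤ = begin
          ∑ (λ u → f u * nbrSum f u)                   ≤⟨ sum-mono-≤ at ⟩
          ∑ (λ u → f u * ∑ f + -1ℤ * f u)            ≡⟨ ∑-distrib-+ (λ u → f u * ∑ f) (λ u → -1ℤ * f u) ⟩
          ∑ (λ u → f u * ∑ f) + ∑ (λ u → -1ℤ * f u) ≡⟨ cong₂ _+_ (sum-*ʳ (∑ f) f) (sum-*ˡ -1ℤ f) ⟩
          ∑ f * ∑ f + -1ℤ * ∑ f                    ≡⟨ cong (_+_ (∑ f * ∑ f)) (-1*i≡-i (∑ f)) ⟩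
          ∑ f * ∑ f - ∑ f                          ∎
          where
          open ≤-Reasoning
          split : ∀ x y → x * y ≡ x * (y + x) + -1ℤ * (x * x)
          split = solve-∀
          at : ∀ u → f u * nbrSum f u ≤ f u * ∑ f + -1ℤ * f u
          at u = begin
            f u * nbrSum f u                               ≡⟨ split (f u) (nbrSum f u) ⟩
            f u * (nbrSum f u + f u) + -1ℤ * (f u * f u)   ≤⟨ +-mono-≤
              (*-monoˡ-≤-nonNeg (f u) {{nonNegative (0≤f u)}} (nbrSum+self≤sum u 0≤f))
              (≤-reflexive (cong (_*_ -1ℤ) (idem u))) ⟩
            f u * ∑ f + -1ℤ * f u                        ∎

        -- The edges at t are counted once from t and once from their other end.
        2nbrSum≤edgeSum : ∀ t → f t ≡ 1ℤ → nbrSum f t + nbrSum f t ≤ edgeSum f f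
        2nbrSum≤edgeSum t ft≡1 = begin
          nbrSum f t + nbrSum f t                                  ≡⟨ cong (_+_ (nbrSum f t)) (sum-at t (λ _ → nbrSum f t)) ⟨
          nbrSum f t + ∑ (λ u → 𝟙 (t ≟ u) * nbrSum f t)          ≡⟨ ∑-distrib-+ (λ u → A t u * f u) (λ u → 𝟙 (t ≟ u) * nbrSum f t) ⟨
          ∑ (λ u → A t u * f u + 𝟙 (t ≟ u) * nbrSum f t)         ≤⟨ sum-mono-≤ at ⟩
          edgeSum f f                                              ∎
          where
          open ≤-Reasoning
          at : ∀ u → A t u * f u + 𝟙 (t ≟ u) * nbrSum f t ≤ f u * nbrSum f u
          at u with t ≟ u | adj? H t u
          ... | yes refl | yes a = ⊥-elim (adj-irrefl H a)
          ... | yes refl | no _  = ≤-reflexive (trans (+-identityˡ _) (cong (_* nbrSum f u) (sym ft≡1)))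
          ... | no _     | no _  = 0≤* (0≤f u) (0≤nbrSum 0≤f)
          ... | no _     | yes a = begin
            1ℤ * f u + 0ℤ      ≡⟨ trans (+-identityʳ _) (*-comm 1ℤ (f u)) ⟩
            f u * 1ℤ           ≤⟨ *-monoˡ-≤-nonNeg (f u) {{nonNegative (0≤f u)}}
                                    (subst (_≤ nbrSum f u) ft≡1 (term≤nbrSum 0≤f (adj-sym H a))) ⟩
            f u * nbrSum f u   ∎

    module RegularGraph (K : ℤ) (regular : ∀ u → nbrSum (λ _ → 1ℤ) u ≡ K) where

      nbrSum-const : ∀ c u → nbrSum (λ _ → c) u ≡ K * c
      nbrSum-const c u = begin
        nbrSum (λ _ → c) u      ≡⟨ nbrSum-cong (λ _ _ → sym (*-identityʳ c)) ⟩
        nbrSum (λ _ → c * 1ℤ) u ≡⟨ nbrSum-* c (λ _ → 1ℤ) u ⟩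
        c * nbrSum (λ _ → 1ℤ) u ≡⟨ cong (c *_) (regular u) ⟩
        c * K                   ≡⟨ *-comm c K ⟩
        K * c                   ∎
        where open ≡-Reasoning

      opaque
        unfolding edgeSum

        sum-nbrSum : ∀ f → ∑ (nbrSum f) ≡ K * ∑ f
        sum-nbrSum f = begin
          ∑ (nbrSum f)                   ≡⟨ ∑-cong (λ u → sym (*-identityˡ (nbrSum f u))) ⟩
          edgeSum (λ _ → 1ℤ) f             ≡⟨ edgeSum-sym (λ _ → 1ℤ) f ⟩
          ∑ (λ u → f u * nbrSum (λ _ → 1ℤ) u) ≡⟨ ∑-cong (λ u → cong (f u *_) (regular u)) ⟩
          ∑ (λ u → f u * K)              ≡⟨ sum-*ʳ K f ⟩
          ∑ f * K                        ≡⟨ *-comm (∑ f) K ⟩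
          K * ∑ f                        ∎
          where open ≡-Reasoning

      -- The Dirichlet energy Σ (f u − f w)² over the edges vanishes.
      harmonic⇒constant-on-edges : ∀ f → (∀ u → nbrSum f u ≡ K * f u) → ∀ {u w} → Adj H u w → f u ≡ f w
      harmonic⇒constant-on-edges f harmonic {u} {w} a = i-j≡0⇒i≡j (f u) (f w)
        -- The square for one edge at `u` is at most the energy at `u`, and that is a nonnegative
        -- term of a sum equal to zero.
        (reduce (i*j≡0⇒i≡0∨j≡0 (f u - f w) (≤-antisym
          (subst (_ ≤_) (sum≡0⇒term≡0 (λ u → 0≤nbrSum (λ w → 0≤square (f u - f w))) total u)
            (term≤nbrSum {λ w → (f u - f w) * (f u - f w)} (λ w → 0≤square (f u - f w)) a))
          (0≤square (f u - f w)))))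
        where
        open ≡-Reasoning
        expand : ∀ a b → (a - b) * (a - b) ≡ b * b + (a * a + - (a + a) * b)
        expand = solve-∀
        collect : ∀ k s x → s + (k * (x * x) + - (x + x) * (k * x)) ≡ s + (- k) * (x * x)
        collect = solve-∀
        cancel : ∀ k s → k * s + (- k) * s ≡ 0ℤ
        cancel = solve-∀
        sq : V → ℤ
        sq w = f w * f w
        energy : ∀ u → nbrSum (λ w → (f u - f w) * (f u - f w)) u ≡ nbrSum sq u + (- K) * sq u
        energy u = begin
          nbrSum (λ w → (f u - f w) * (f u - f w)) u
            ≡⟨ nbrSum-cong (λ w _ → expand (f u) (f w)) ⟩
          nbrSum (λ w → sq w + (sq u + - (f u + f u) * f w)) u
            ≡⟨ nbrSum-+ sq (λ w → sq u + - (f u + f u) * f w) u ⟩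
          nbrSum sq u + nbrSum (λ w → sq u + - (f u + f u) * f w) u
            ≡⟨ cong (_+_ (nbrSum sq u)) (nbrSum-+ (λ _ → sq u) (λ w → - (f u + f u) * f w) u) ⟩
          nbrSum sq u + (nbrSum (λ _ → sq u) u + nbrSum (λ w → - (f u + f u) * f w) u)
            ≡⟨ cong₂ (λ x y → nbrSum sq u + (x + y)) (nbrSum-const (sq u) u)
                 (trans (nbrSum-* (- (f u + f u)) f u) (cong (- (f u + f u) *_) (harmonic u))) ⟩
          nbrSum sq u + (K * sq u + - (f u + f u) * (K * f u))
            ≡⟨ collect K (nbrSum sq u) (f u) ⟩
          nbrSum sq u + (- K) * sq u ∎
        total : ∑ (λ u → nbrSum (λ w → (f u - f w) * (f u - f w)) u) ≡ 0ℤ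
        total = begin
          ∑ (λ u → nbrSum (λ w → (f u - f w) * (f u - f w)) u) ≡⟨ ∑-cong energy ⟩
          ∑ (λ u → nbrSum sq u + (- K) * sq u)   ≡⟨ ∑-distrib-+ (nbrSum sq) (λ u → (- K) * sq u) ⟩
          ∑ (nbrSum sq) + ∑ (λ u → (- K) * sq u) ≡⟨ cong₂ _+_ (sum-nbrSum sq) (sum-*ˡ (- K) sq) ⟩
          K * ∑ sq + (- K) * ∑ sq              ≡⟨ cancel K (∑ sq) ⟩
          0ℤ                                       ∎

  -- Parity kernels and the polynomials H.

  -- ξ i j = 1 if j ≤ i and j ≡ i modulo 2, and 0 otherwise.
  ξ : ℕ → ℕ → ℤ
  ξ zero          zero    = 1ℤ
  ξ zero          (suc j) = 0ℤ
  ξ (suc zero)    zero    = 0ℤ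
  ξ (suc (suc i)) zero    = ξ i zero
  ξ (suc i)       (suc j) = ξ i j

  ξ-vanish : ∀ {i j} → i ℕ.< j → ξ i j ≡ 0ℤ
  ξ-vanish {zero}  (s≤s _)  = refl
  ξ-vanish {suc zero} (s≤s lt) = ξ-vanish lt
  ξ-vanish {suc (suc i)} (s≤s lt) = ξ-vanish lt

  ξ-suc-suc : ∀ i j → ξ (suc i) (suc j) ≡ ξ i j
  ξ-suc-suc zero    j = refl
  ξ-suc-suc (suc i) j = refl

  ξ-self : ∀ i → ξ i i ≡ 1ℤ
  ξ-self zero    = refl
  ξ-self (suc i) = trans (ξ-suc-suc i i) (ξ-self i)

  -- Of two consecutive integers exactly one has the parity of `j`.
  ξ-pair : ∀ {i j} → j ℕ.≤ suc i → ξ (suc i) j + ξ i j ≡ 1ℤ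
  ξ-pair {zero}  {zero}  _ = refl
  ξ-pair {zero}  {suc zero} _ = refl
  ξ-pair {zero}  {suc (suc j)} (s≤s ())
  ξ-pair {suc i} {zero}  _ = trans (+-comm (ξ i 0) (ξ (suc i) 0)) (ξ-pair {i} z≤n)
  ξ-pair {suc i} {suc j} (s≤s le) = trans (cong (_+_ (ξ (suc i) j)) (ξ-suc-suc i j)) (ξ-pair le)

  ξ-skip : ∀ {i j} → j ℕ.< i → ξ i j ≡ ξ i (suc (suc j))
  ξ-skip {suc zero} {zero} _ = refl
  ξ-skip {suc (suc zero)} {zero} _ = refl
  ξ-skip {suc (suc (suc i))} {zero} _ = refl
  ξ-skip {suc zero} {suc j} (s≤s ())
  ξ-skip {suc (suc i)} {suc j} (s≤s lt) = ξ-skip lt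

  odd : ℕ → ℤ
  odd zero    = 0ℤ
  odd (suc j) = 1ℤ - odd j

  odd-suc-suc : ∀ j → odd (suc (suc j)) ≡ odd j
  odd-suc-suc j = lemma (odd j)
    where
    lemma : ∀ x → 1ℤ - (1ℤ - x) ≡ x
    lemma = solve-∀

  odd-double : ∀ m → odd (m ℕ.+ m) ≡ 0ℤ
  odd-double zero    = refl
  odd-double (suc m) = trans (cong (λ x → 1ℤ - odd x) (ℕₚ.+-suc m m))
    (trans (odd-suc-suc (m ℕ.+ m)) (odd-double m))

  ξ-odd : ∀ {i j} → j ℕ.≤ i → odd i ≡ 1ℤ → ξ i j ≡ odd j
  ξ-even : ∀ {i j} → j ℕ.≤ i → odd i ≡ 0ℤ → ξ i j ≡ 1ℤ - odd j

  ξ-odd {suc zero}    {zero} _ _ = refl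
  ξ-odd {suc (suc i)} {zero} _ o = ξ-odd {i} z≤n (trans (sym (odd-suc-suc i)) o)
  ξ-odd {suc i} {suc j} (s≤s le) o = trans (ξ-suc-suc i j) (ξ-even le (lemma (odd i) o))
    where
    lemma : ∀ x → 1ℤ - x ≡ 1ℤ → x ≡ 0ℤ
    lemma x e = trans (solve′ x) (cong (_-_ 1ℤ) e)
      where
      solve′ : ∀ x → x ≡ 1ℤ - (1ℤ - x)
      solve′ = solve-∀

  ξ-even {zero} {zero} _ _ = refl
  ξ-even {suc zero} {zero} _ ()
  ξ-even {suc (suc i)} {zero} _ o = ξ-even {i} z≤n (trans (sym (odd-suc-suc i)) o)
  ξ-even {suc i} {suc j} (s≤s le) o = trans (ξ-suc-suc i j) (trans (ξ-odd le (sym (i-j≡0⇒i≡j 1ℤ (odd i) o))) (sym (odd-suc-suc j)))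

  -- For a K-regular graph of girth greater than 2 i, H K i evaluated at the adjacency
  -- matrix has the entries ξ i (dist u v).
  H : ℤ → ℕ → ℤ → ℤ
  H K zero          x = 1ℤ
  H K (suc zero)    x = x
  H K (suc (suc i)) x = x * H K (suc i) x - (K - 1ℤ) * H K i x

  -- At x = `K`, the eigenvalue of the constant vector, the second-order recurrence collapses to
  -- that of the geometric sums in the Moore bound.
  H-suc : ∀ K i → H K (suc i) K ≡ 1ℤ + (K - 1ℤ) * H K i K
  H-suc K zero    = lemma K
    where
    lemma : ∀ K → K ≡ 1ℤ + (K - 1ℤ) * 1ℤ
    lemma = solve-∀
  H-suc K (suc i) = begin
    K * H K (suc i) K - (K - 1ℤ) * H K i K   ≡⟨ split K (H K (suc i) K) (H K i K) ⟩
    (K - 1ℤ) * H K (suc i) K + (H K (suc i) K - (K - 1ℤ) * H K i K)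
      ≡⟨ cong (λ x → (K - 1ℤ) * H K (suc i) K + (x - (K - 1ℤ) * H K i K)) (H-suc K i) ⟩
    (K - 1ℤ) * H K (suc i) K + (1ℤ + (K - 1ℤ) * H K i K - (K - 1ℤ) * H K i K)
      ≡⟨ cancel ((K - 1ℤ) * H K (suc i) K) ((K - 1ℤ) * H K i K) ⟩
    1ℤ + (K - 1ℤ) * H K (suc i) K            ∎
    where
    open ≡-Reasoning
    split : ∀ K x y → K * x - (K - 1ℤ) * y ≡ (K - 1ℤ) * x + (x - (K - 1ℤ) * y)
    split = solve-∀
    cancel : ∀ a b → a + (1ℤ + b - b) ≡ 1ℤ + a
    cancel = solve-∀

  geometricSum : ℕ → ℕ → ℕ
  geometricSum q n = sum (map (q ℕ.^_) (upTo n))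

  geometricSum-suc : ∀ q n → geometricSum q (suc n) ≡ 1 ℕ.+ q ℕ.* geometricSum q n
  geometricSum-suc q n = cong suc (pull n id)
    where
    pull : ∀ n (f : ℕ → ℕ) →
      sum (map (q ℕ.^_) (applyUpTo (suc ∘ f) n)) ≡ q ℕ.* sum (map (q ℕ.^_) (applyUpTo f n))
    pull zero    f = sym (ℕₚ.*-zeroʳ q)
    pull (suc n) f = trans (cong ((q ℕ.^ suc (f 0)) ℕ.+_) (pull n (f ∘ suc)))
      (sym (ℕₚ.*-distribˡ-+ q (q ℕ.^ f 0) _))

  H≡geometricSum : ∀ q i → H (+ suc q) i (+ suc q) ≡ + geometricSum q (suc i)
  H≡geometricSum q zero    = refl
  H≡geometricSum q (suc i) = begin
    H (+ suc q) (suc i) (+ suc q)          ≡⟨ H-suc (+ suc q) i ⟩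
    1ℤ + + q * H (+ suc q) i (+ suc q)     ≡⟨ cong (λ x → 1ℤ + + q * x) (H≡geometricSum q i) ⟩
    1ℤ + + q * + geometricSum q (suc i)    ≡⟨ cong (_+_ 1ℤ) (sym (pos-* q (geometricSum q (suc i)))) ⟩
    + (1 ℕ.+ q ℕ.* geometricSum q (suc i)) ≡⟨ cong +_ (sym (geometricSum-suc q (suc i))) ⟩
    + geometricSum q (suc (suc i))         ∎
    where open ≡-Reasoning

  -- The polynomials H modulo 2 and 4.

  2∣x⊎2∣x-1 : ∀ x → + 2 ∣ x ⊎ + 2 ∣ x - 1ℤ
  2∣x⊎2∣x-1 x with x %ℕ 2 | n%ℕd<d x 2 | a≡a%ℕn+[a/ℕn]*n x 2
  ... | 0 | _ | eq = inj₁ (divides (x /ℕ 2) (trans eq (+-identityˡ _)))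
  ... | 1 | _ | eq = inj₂ (divides (x /ℕ 2) (trans (cong (_- 1ℤ) eq) (cancel _)))
    where
    cancel : ∀ y → 1ℤ + y - 1ℤ ≡ y
    cancel = solve-∀
  ... | suc (suc _) | s≤s (s≤s ()) | _

  *-∣-* : ∀ {a b x y} → a ∣ x → b ∣ y → a * b ∣ x * y
  *-∣-* {a} {b} (divides p refl) (divides q refl) = divides (p * q) (rearrange p a q b)
    where
    rearrange : ∀ p a q b → p * a * (q * b) ≡ p * q * (a * b)
    rearrange = solve-∀

  -- As `K` - 1 is even, the recurrence modulo 2 only multiplies by x at each step.
  H-odd : ∀ {K x} → + 2 ∣ K - 1ℤ → + 2 ∣ x - 1ℤ → ∀ i → + 2 ∣ H K i x - 1ℤ
  H-odd p q zero          = divides 0ℤ refl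
  H-odd p q (suc zero)    = q
  H-odd {K} {x} p q (suc (suc i)) = subst (+ 2 ∣_) (expand x (H K (suc i) x) ((K - 1ℤ) * H K i x))
    (∣m∣n⇒∣m-n (∣m∣n⇒∣m+n (∣m⇒∣m*n (H K (suc i) x) q) (H-odd p q (suc i))) (∣m⇒∣m*n (H K i x) p))
    where
    expand : ∀ x y z → (x - 1ℤ) * y + (y - 1ℤ) - z ≡ x * y - z - 1ℤ
    expand = solve-∀

  H-even : ∀ {K x} → + 2 ∣ K - 1ℤ → + 2 ∣ x → ∀ i → + 2 ∣ H K (suc i) x
  H-even p q zero = q
  H-even {K} {x} p q (suc i) = ∣m∣n⇒∣m-n (∣m⇒∣m*n (H K (suc i) x) q) (∣m⇒∣m*n (H K i x) p)

  -- Both terms of the recurrence are products of two even numbers. The index starts at 3 so that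
  -- the second term does not contain H₀ = 1.
  4∣H : ∀ {K x} → + 2 ∣ K - 1ℤ → + 2 ∣ x → ∀ i → + 4 ∣ H K (3 ℕ.+ i) x
  4∣H p q i = ∣m∣n⇒∣m-n (*-∣-* q (H-even p q (suc i))) (*-∣-* p (H-even p q i))

  H≢-2 : ∀ {K} → + 2 ∣ K - 1ℤ → ∀ i x → + 2 + H K (3 ℕ.+ i) x ≢ 0ℤ
  H≢-2 {K} p i x eq with 2∣x⊎2∣x-1 x
  ... | inj₁ q = ℕᵈ.>⇒∤ (s≤s (s≤s (s≤s z≤n))) (∣⇒∣ᵤ (subst (+ 4 ∣_) (value (H K (3 ℕ.+ i) x) eq) (4∣H {K} {x} p q i)))
    where
    value : ∀ y → + 2 + y ≡ 0ℤ → y ≡ -[1+ 1 ]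
    value y e = trans (shift y) (cong (_- + 2) e)
      where
      shift : ∀ y → y ≡ + 2 + y - + 2
      shift = solve-∀
  ... | inj₂ q = from-no (2 ℕᵈ.∣? 3) (∣⇒∣ᵤ (subst (+ 2 ∣_) (value (H K (3 ℕ.+ i) x) eq) (H-odd {K} {x} p q (3 ℕ.+ i))))
    where
    value : ∀ y → + 2 + y ≡ 0ℤ → y - 1ℤ ≡ -[1+ 2 ]
    value y e = trans (shift y) (cong (_- + 3) e)
      where
      shift : ∀ y → y - 1ℤ ≡ + 2 + y - + 3
      shift = solve-∀

  -- Indicators of distance levels.

  𝟙-idem : ∀ {p} {P : Set p} (P? : Dec P) → 𝟙 P? * 𝟙 P? ≡ 𝟙 P?
  𝟙-idem (yes _) = refl
  𝟙-idem (no _)  = refl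

  opaque
    level : ℕ → ℕ → ℤ
    level m j = 𝟙 (j ℕ.≟ m)

    level-self : ∀ m → level m m ≡ 1ℤ
    level-self m = 𝟙-yes (m ℕ.≟ m) refl

    level-≢ : ∀ {m j} → j ≢ m → level m j ≡ 0ℤ
    level-≢ {m} {j} = 𝟙-no (j ℕ.≟ m)

    0≤level : ∀ m j → 0ℤ ≤ level m j
    0≤level m j = 0≤𝟙 (j ℕ.≟ m)

    level≤1 : ∀ m j → level m j ≤ 1ℤ
    level≤1 m j with j ℕ.≟ m
    ... | yes _ = ≤-refl
    ... | no _  = +≤+ z≤n

    level-idem : ∀ m j → level m j * level m j ≡ level m j
    level-idem m j = 𝟙-idem (j ℕ.≟ m)

    level-𝟙 : ∀ {m j} {P : Set} (P? : Dec P) → (j ≡ m → P) → (P → j ≡ m) → level m j ≡ 𝟙 P?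
    level-𝟙 {m} {j} = 𝟙-cong (j ℕ.≟ m)

    -- Lets a bound valid only on one level be used in a sum over all vertices, once it is
    -- multiplied by the indicator of the level.
    level-guard-≤ : ∀ {m j x y} → (j ≡ m → x ≤ y) → level m j * x ≤ level m j * y
    level-guard-≤ {m} {j} {x} {y} h with j ℕ.≟ m
    ... | yes eq = *-monoˡ-≤-nonNeg 1ℤ (h eq)
    ... | no _   = ≤-refl

  level-guard : ∀ {m j x y} → (j ≡ m → x ≡ y) → level m j * x ≡ level m j * y
  level-guard h = ≤-antisym (level-guard-≤ (≤-reflexive ∘ h)) (level-guard-≤ (≤-reflexive ∘ sym ∘ h))

  level-< : ∀ {m j} → j ℕ.< m → level m j ≡ 0ℤ
  level-< lt = level-≢ (ℕₚ.<⇒≢ lt)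

  level-> : ∀ {m j} → m ℕ.< j → level m j ≡ 0ℤ
  level-> lt = level-≢ (ℕₚ.>⇒≢ lt)

  -- Tree-like neighbourhoods and polynomials in the adjacency matrix.

  private
    halve : ∀ {d j} → 2 ℕ.* d ℕ.≤ j ℕ.+ j → d ℕ.≤ j
    halve {d} {j} le = ℕₚ.*-cancelˡ-≤ 2 (subst (2 ℕ.* d ℕ.≤_) (cong (j ℕ.+_) (sym (ℕₚ.+-identityʳ j))) le)

    halve-suc : ∀ {d j} → 2 ℕ.* d ℕ.≤ j ℕ.+ suc j → d ℕ.≤ j
    halve-suc {d} {j} le with d ℕ.≤? j
    ... | yes d≤j = d≤j
    ... | no d≰j = contradiction
      (ℕₚ.+-mono-≤ (ℕₚ.≰⇒> d≰j) (ℕₚ.≤-trans (ℕₚ.≰⇒> d≰j) (ℕₚ.m≤m+n d 0))) (ℕₚ.<⇒≱ (s≤s le))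

  -- Here d = 2 + e, and distances are truncated at d + 2.
  module LargeGirth {n} (G : Graph (Fin n)) (e : ℕ) (K : ℤ)
    (regular : ∀ u → Neighbours.nbrSum G (λ _ → 1ℤ) u ≡ K)
    (girth : HasGirth G (2 ℕ.* (2 ℕ.+ e))) where

    private V = Fin n

    open Distance G (4 ℕ.+ e) (s≤s z≤n) public
    open Girth girth
    open Neighbours G public
    open RegularGraph K regular public

    no-level-edge : ∀ {u w v j} → Adj G u w → dist u v ≡ j → dist w v ≡ j → j ℕ.< 2 ℕ.+ e → ⊥
    no-level-edge a eu ew lt = ℕₚ.<⇒≱ lt
      (halve-suc (level-edge⇒girth≤ a eu ew (ℕₚ.≤-trans lt (ℕₚ.m≤n+m _ 2))))

    parent-unique : ∀ {u w w′ v j} → Adj G u w → Adj G u w′ → dist u v ≡ suc j →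
      dist w v ≡ j → dist w′ v ≡ j → suc j ℕ.< 2 ℕ.+ e → w ≡ w′
    parent-unique {w = w} {w′} {j = j} a a′ eu ew ew′ lt with w ≟ w′
    ... | yes w≡w′ = w≡w′
    ... | no w≢w′ = contradiction
      (halve (subst (2 ℕ.* (2 ℕ.+ e) ℕ.≤_) (ℕₚ.+-suc j (suc j)) (two-parents⇒girth≤ a a′ w≢w′ eu ew ew′ (ℕₚ.≤-trans lt (ℕₚ.m≤n+m _ 2)))))
      (ℕₚ.<⇒≱ lt)

    nbrSum-root : ∀ {u v} (f : ℕ → ℤ) → dist u v ≡ 0 → nbrSum (λ w → f (dist w v)) u ≡ K * f 1
    nbrSum-root {u} {v} f eu = trans (nbrSum-cong at) (nbrSum-const (f 1) u)
      where
      at : ∀ w → Adj G u w → f (dist w v) ≡ f 1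
      at w a with dist w v in ew | subst (λ m → dist w v ℕ.≤ suc m) eu (dist-step v (adj-sym G a))
      ... | 0 | _ = ⊥-elim (no-level-edge a eu ew (s≤s z≤n))
      ... | 1 | _ = refl
      ... | suc (suc _) | s≤s ()

    -- Below distance d the graph looks like a tree from `v`: one neighbour of `u` is nearer, none
    -- is on its level, and the other `K` - 1 are farther.
    nbrSum-inner : ∀ {u v j} (f : ℕ → ℤ) → dist u v ≡ suc j → suc j ℕ.< 2 ℕ.+ e →
      nbrSum (λ w → f (dist w v)) u ≡ f j + (K - 1ℤ) * f (suc (suc j))
    nbrSum-inner {u} {v} {j} f eu lt with parent eu (ℕₚ.≤-trans lt (ℕₚ.m≤n+m _ 2))
    ... | p , a , ep = begin
      nbrSum (λ w → f (dist w v)) u                                      ≡⟨ nbrSum-cong at ⟩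
      -- The constant value of the farther neighbours, with a correction at the parent `p` alone.
      nbrSum (λ w → f (2 ℕ.+ j) + 𝟙 (p ≟ w) * (f j - f (2 ℕ.+ j))) u
        ≡⟨ nbrSum-+ (λ _ → f (2 ℕ.+ j)) (λ w → 𝟙 (p ≟ w) * (f j - f (2 ℕ.+ j))) u ⟩
      nbrSum (λ _ → f (2 ℕ.+ j)) u + nbrSum (λ w → 𝟙 (p ≟ w) * (f j - f (2 ℕ.+ j))) u
        ≡⟨ cong₂ _+_ (nbrSum-const (f (2 ℕ.+ j)) u) (nbrSum-at (f j - f (2 ℕ.+ j)) a) ⟩
      K * f (2 ℕ.+ j) + (f j - f (2 ℕ.+ j))                              ≡⟨ collect K (f j) (f (2 ℕ.+ j)) ⟩
      f j + (K - 1ℤ) * f (2 ℕ.+ j)                                       ∎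
      where
      open ≡-Reasoning
      collect : ∀ K x y → K * y + (x - y) ≡ x + (K - 1ℤ) * y
      collect = solve-∀
      toParent : ∀ x y → x ≡ y + 1ℤ * (x - y)
      toParent = solve-∀
      at : ∀ w → Adj G u w → f (dist w v) ≡ f (2 ℕ.+ j) + 𝟙 (p ≟ w) * (f j - f (2 ℕ.+ j))
      at w aw with p ≟ w | adj-levels v aw eu
      ... | yes refl | _ = trans (cong f ep) (toParent (f j) (f (2 ℕ.+ j)))
      ... | no p≢w | inj₁ ew = ⊥-elim (p≢w (parent-unique a aw eu ep ew lt))
      ... | no p≢w | inj₂ (inj₁ ew) = ⊥-elim (no-level-edge aw eu ew lt)
      ... | no p≢w | inj₂ (inj₂ ew) = trans (cong f ew) (sym (+-identityʳ _))

    nbrSum-outer : ∀ {u v j} (f : ℕ → ℤ) → dist u v ≡ suc j → (∀ {i} → j ℕ.≤ i → f i ≡ 0ℤ) →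
      nbrSum (λ w → f (dist w v)) u ≡ 0ℤ
    nbrSum-outer {u} {v} {j} f eu vanish = trans
      (nbrSum-cong λ w a → vanish (ℕₚ.≤-pred (subst (ℕ._≤ suc (dist w v)) eu (dist-step v a))))
      (trans (nbrSum-const 0ℤ u) (*-zeroʳ K))

    nbrSum-ξ₀ : ∀ u v → nbrSum (λ w → ξ 0 (dist w v)) u ≡ ξ 1 (dist u v)
    nbrSum-ξ₀ u v with dist u v in eu
    ... | zero = trans (nbrSum-root (ξ 0) eu) (*-zeroʳ K)
    ... | suc j with suc j ℕ.<? 2 ℕ.+ e
    ...   | yes lt = trans (nbrSum-inner (ξ 0) eu lt) (trans (cong (_+_ (ξ 0 j)) (*-zeroʳ (K - 1ℤ))) (+-identityʳ (ξ 0 j)))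
    ...   | no ge with ℕₚ.≤-pred (ℕₚ.≮⇒≥ ge)
    ...     | 0<j = trans (nbrSum-outer (ξ 0) eu λ le → ξ-vanish (ℕₚ.≤-trans (ℕₚ.≤-trans (s≤s z≤n) 0<j) le))
      (sym (ξ-vanish (ℕₚ.≤-trans (s≤s z≤n) 0<j)))

    -- The recurrence of `H` for the matrices with entries `ξ i (dist u v)`. The bound on `i` keeps
    -- the indices at most d - 1, where the tree-like counts suffice.
    nbrSum-ξ : ∀ {i} → i ℕ.< e → ∀ u v →
      nbrSum (λ w → ξ (suc i) (dist w v)) u ≡ ξ (2 ℕ.+ i) (dist u v) + (K - 1ℤ) * ξ i (dist u v)
    nbrSum-ξ {i} i<e u v with dist u v in eu
    ... | zero = trans (nbrSum-root (ξ (suc i)) eu) (trans (cong (K *_) (ξ-suc-suc i 0)) (split K (ξ i 0)))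
      where
      split : ∀ K x → K * x ≡ x + (K - 1ℤ) * x
      split = solve-∀
    ... | suc j with suc j ℕ.<? 2 ℕ.+ e
    ...   | yes lt = trans (nbrSum-inner (ξ (suc i)) eu lt)
      (cong (λ x → ξ (suc i) j + (K - 1ℤ) * x) (ξ-suc-suc i (suc j)))
    ...   | no ge with ℕₚ.≤-pred (ℕₚ.≮⇒≥ ge)
    ...     | e<j = trans (nbrSum-outer (ξ (suc i)) eu λ le → ξ-vanish (ℕₚ.≤-trans (s≤s i<e) (ℕₚ.≤-trans e<j le)))
      (sym (trans (cong₂ (λ x y → x + (K - 1ℤ) * y)
          (ξ-vanish {suc i} (ℕₚ.≤-trans (s≤s i<e) e<j))
          (ξ-vanish {i} (ℕₚ.≤-trans i<e (ℕₚ.≤-trans (ℕₚ.n≤1+n e) (ℕₚ.m≤n⇒m≤1+n e<j)))))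
        (trans (+-identityˡ _) (*-zeroʳ (K - 1ℤ)))))

    -- Summing the matrix recurrence over all vertices replaces the adjacency matrix by the factor
    -- `K`.
    sum-ξ : ∀ i → i ℕ.≤ suc e → ∀ v → ∑ (λ w → ξ i (dist w v)) ≡ H K i K
    sum-ξ zero _ v = trans (∑-cong at) (sum-at v (λ _ → 1ℤ))
      where
      at : ∀ w → ξ 0 (dist w v) ≡ 𝟙 (v ≟ w) * 1ℤ
      at w with dist w v in ew | v ≟ w
      ... | zero  | yes _ = refl
      ... | zero  | no v≢w = contradiction (sym (dist≡0⇒≡ ew)) v≢w
      ... | suc _ | yes refl = contradiction (trans (sym (dist-self v)) ew) λ ()
      ... | suc _ | no _ = refl
    sum-ξ (suc zero) _ v = begin
      ∑ (λ w → ξ 1 (dist w v))                           ≡⟨ ∑-cong (λ u → sym (nbrSum-ξ₀ u v)) ⟩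
      ∑ (nbrSum (λ w → ξ 0 (dist w v)))                  ≡⟨ sum-nbrSum (λ w → ξ 0 (dist w v)) ⟩
      K * ∑ (λ w → ξ 0 (dist w v))                       ≡⟨ cong (K *_) (sum-ξ 0 z≤n v) ⟩
      K * 1ℤ                                               ≡⟨ *-identityʳ K ⟩
      K                                                    ∎
      where open ≡-Reasoning
    sum-ξ (suc (suc i)) (s≤s i<e) v = begin
      Σξ (2 ℕ.+ i)                                          ≡⟨ isolate (Σξ (2 ℕ.+ i)) ((K - 1ℤ) * Σξ i) ⟩
      Σξ (2 ℕ.+ i) + (K - 1ℤ) * Σξ i - (K - 1ℤ) * Σξ i      ≡⟨ cong (λ x → x - (K - 1ℤ) * Σξ i) (sym recurrence) ⟩
      K * Σξ (suc i) - (K - 1ℤ) * Σξ i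
        ≡⟨ cong₂ (λ x y → K * x - (K - 1ℤ) * y) (sum-ξ (suc i) (ℕₚ.m≤n⇒m≤1+n i<e) v)
             (sum-ξ i (ℕₚ.≤-trans (ℕₚ.n≤1+n i) (ℕₚ.m≤n⇒m≤1+n i<e)) v) ⟩
      H K (2 ℕ.+ i) K                                       ∎
      where
      open ≡-Reasoning
      Σξ : ℕ → ℤ
      Σξ i = ∑ (λ w → ξ i (dist w v))
      isolate : ∀ x y → x ≡ x + y - y
      isolate = solve-∀
      recurrence : K * Σξ (suc i) ≡ Σξ (2 ℕ.+ i) + (K - 1ℤ) * Σξ i
      recurrence = begin
        K * Σξ (suc i)                              ≡⟨ sum-nbrSum (λ w → ξ (suc i) (dist w v)) ⟨
        ∑ (nbrSum (λ w → ξ (suc i) (dist w v)))   ≡⟨ ∑-cong (λ u → nbrSum-ξ i<e u v) ⟩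
        ∑ (λ u → ξ (2 ℕ.+ i) (dist u v) + (K - 1ℤ) * ξ i (dist u v))
          ≡⟨ ∑-distrib-+ (λ u → ξ (2 ℕ.+ i) (dist u v)) (λ u → (K - 1ℤ) * ξ i (dist u v)) ⟩
        Σξ (2 ℕ.+ i) + ∑ (λ u → (K - 1ℤ) * ξ i (dist u v))
          ≡⟨ cong (_+_ (Σξ (2 ℕ.+ i))) (sum-*ˡ (K - 1ℤ) (λ u → ξ i (dist u v))) ⟩
        Σξ (2 ℕ.+ i) + (K - 1ℤ) * Σξ i              ∎

    -- H K i evaluated at the adjacency matrix.
    T : ℕ → (V → ℤ) → V → ℤ
    T zero          f = f
    T (suc zero)    f = nbrSum f
    T (suc (suc i)) f u = nbrSum (T (suc i) f) u - (K - 1ℤ) * T i f u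

    T-kernel : ∀ i → i ℕ.≤ suc e → ∀ f u → T i f u ≡ ∑ (λ v → ξ i (dist u v) * f v)
    T-kernel zero _ f u = sym (trans (∑-cong at) (sum-at u f))
      where
      at : ∀ v → ξ 0 (dist u v) * f v ≡ 𝟙 (u ≟ v) * f v
      at v with dist u v in eu | u ≟ v
      ... | zero  | yes _ = refl
      ... | zero  | no u≢v = contradiction (dist≡0⇒≡ eu) u≢v
      ... | suc _ | yes refl = contradiction (trans (sym (dist-self u)) eu) λ ()
      ... | suc _ | no _ = refl
    T-kernel (suc zero) _ f u = begin
      nbrSum f u                                             ≡⟨ nbrSum-cong (λ w _ → T-kernel 0 z≤n f w) ⟩
      nbrSum (λ w → ∑ (λ v → ξ 0 (dist w v) * f v)) u      ≡⟨ nbrSum-linear (λ w v → ξ 0 (dist w v)) f u ⟩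
      ∑ (λ v → nbrSum (λ w → ξ 0 (dist w v)) u * f v)      ≡⟨ ∑-cong (λ v → cong (_* f v) (nbrSum-ξ₀ u v)) ⟩
      ∑ (λ v → ξ 1 (dist u v) * f v)                       ∎
      where open ≡-Reasoning
    T-kernel (suc (suc i)) (s≤s i<e) f u = begin
      nbrSum (T (suc i) f) u - (K - 1ℤ) * T i f u
        ≡⟨ cong₂ (λ x y → x - (K - 1ℤ) * y)
             (nbrSum-cong (λ w _ → T-kernel (suc i) (ℕₚ.m≤n⇒m≤1+n i<e) f w))
             (T-kernel i (ℕₚ.≤-trans (ℕₚ.n≤1+n i) (ℕₚ.m≤n⇒m≤1+n i<e)) f u) ⟩
      nbrSum (λ w → ∑ (λ v → ξ (suc i) (dist w v) * f v)) u - (K - 1ℤ) * Σξ i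
        ≡⟨ cong (_- (K - 1ℤ) * Σξ i) recurrence ⟩
      Σξ (2 ℕ.+ i) + (K - 1ℤ) * Σξ i - (K - 1ℤ) * Σξ i
        ≡⟨ isolate (Σξ (2 ℕ.+ i)) ((K - 1ℤ) * Σξ i) ⟨
      Σξ (2 ℕ.+ i)  ∎
      where
      open ≡-Reasoning
      Σξ : ℕ → ℤ
      Σξ i = ∑ (λ v → ξ i (dist u v) * f v)
      isolate : ∀ x y → x ≡ x + y - y
      isolate = solve-∀
      expand : ∀ x c y z → (x + c * y) * z ≡ x * z + c * (y * z)
      expand = solve-∀
      recurrence : nbrSum (λ w → ∑ (λ v → ξ (suc i) (dist w v) * f v)) u ≡ Σξ (2 ℕ.+ i) + (K - 1ℤ) * Σξ i
      recurrence = begin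
        nbrSum (λ w → ∑ (λ v → ξ (suc i) (dist w v) * f v)) u
          ≡⟨ nbrSum-linear (λ w v → ξ (suc i) (dist w v)) f u ⟩
        ∑ (λ v → nbrSum (λ w → ξ (suc i) (dist w v)) u * f v)
          ≡⟨ ∑-cong (λ v → trans (cong (_* f v) (nbrSum-ξ i<e u v))
               (expand (ξ (2 ℕ.+ i) (dist u v)) (K - 1ℤ) (ξ i (dist u v)) (f v))) ⟩
        ∑ (λ v → ξ (2 ℕ.+ i) (dist u v) * f v + (K - 1ℤ) * (ξ i (dist u v) * f v))
          ≡⟨ ∑-distrib-+ (λ v → ξ (2 ℕ.+ i) (dist u v) * f v) (λ v → (K - 1ℤ) * (ξ i (dist u v) * f v)) ⟩
        Σξ (2 ℕ.+ i) + ∑ (λ v → (K - 1ℤ) * (ξ i (dist u v) * f v))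
          ≡⟨ cong (_+_ (Σξ (2 ℕ.+ i))) (sum-*ˡ (K - 1ℤ) (λ v → ξ i (dist u v) * f v)) ⟩
        Σξ (2 ℕ.+ i) + (K - 1ℤ) * Σξ i ∎

    T-nbrSum : ∀ i f u → T i (nbrSum f) u ≡ nbrSum (T i f) u
    T-nbrSum zero       f u = refl
    T-nbrSum (suc zero) f u = refl
    T-nbrSum (suc (suc i)) f u = begin
      nbrSum (T (suc i) (nbrSum f)) u - (K - 1ℤ) * T i (nbrSum f) u
        ≡⟨ cong₂ (λ x y → x - (K - 1ℤ) * y) (nbrSum-cong (λ w _ → T-nbrSum (suc i) f w)) (T-nbrSum i f u) ⟩
      nbrSum (nbrSum (T (suc i) f)) u - (K - 1ℤ) * nbrSum (T i f) u
        ≡⟨ cong (λ x → nbrSum (nbrSum (T (suc i) f)) u - x) (nbrSum-* (K - 1ℤ) (T i f) u) ⟨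
      nbrSum (nbrSum (T (suc i) f)) u - nbrSum (λ w → (K - 1ℤ) * T i f w) u
        ≡⟨ nbrSum-- (nbrSum (T (suc i) f)) (λ w → (K - 1ℤ) * T i f w) u ⟨
      nbrSum (T (2 ℕ.+ i) f) u ∎
      where open ≡-Reasoning

    -- The adjacency matrix acts triangularly on the span of `f` and the constants, with eigenvalue
    -- `θ` modulo constants, so a polynomial in it acts by its value at `θ`.
    T-affine : ∀ {f θ c} → (∀ u → nbrSum f u ≡ θ * f u + c) →
      ∀ i → ∃[ c′ ] (∀ u → T i f u ≡ H K i θ * f u + c′)
    T-affine {f} h zero = 0ℤ , λ u → sym (trans (+-identityʳ _) (*-identityˡ _))
    T-affine {c = c} h (suc zero) = c , h
    T-affine {f} {θ} {c} h (suc (suc i)) with T-affine h (suc i) | T-affine h i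
    ... | c₁ , h₁ | c₂ , h₂ = H K (suc i) θ * c + K * c₁ - (K - 1ℤ) * c₂ , λ u → begin
      nbrSum (T (suc i) f) u - (K - 1ℤ) * T i f u
        ≡⟨ cong₂ (λ x y → x - (K - 1ℤ) * y) (nbrSum-cong (λ w _ → h₁ w)) (h₂ u) ⟩
      nbrSum (λ w → H K (suc i) θ * f w + c₁) u - (K - 1ℤ) * (H K i θ * f u + c₂)
        ≡⟨ cong (_- (K - 1ℤ) * (H K i θ * f u + c₂)) (trans
             (nbrSum-+ (λ w → H K (suc i) θ * f w) (λ _ → c₁) u)
             (cong₂ _+_ (trans (nbrSum-* (H K (suc i) θ) f u) (cong (H K (suc i) θ *_) (h u))) (nbrSum-const c₁ u))) ⟩
      H K (suc i) θ * (θ * f u + c) + K * c₁ - (K - 1ℤ) * (H K i θ * f u + c₂)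
        ≡⟨ collect (H K (suc i) θ) θ (f u) c (K * c₁) (K - 1ℤ) (H K i θ) c₂ ⟩
      (θ * H K (suc i) θ - (K - 1ℤ) * H K i θ) * f u + (H K (suc i) θ * c + K * c₁ - (K - 1ℤ) * c₂) ∎
      where
      open ≡-Reasoning
      collect : ∀ p θ x c s q r c₂ → p * (θ * x + c) + s - q * (r * x + c₂)
        ≡ (θ * p - q * r) * x + (p * c + s - q * c₂)
      collect = solve-∀

  -- Diameter and bipartiteness by counting edges between levels.

  0≤+ : ∀ {i j} → 0ℤ ≤ i → 0ℤ ≤ j → 0ℤ ≤ i + j
  0≤+ = +-mono-≤

  0≰-1 : ¬ (0ℤ ≤ -1ℤ)
  0≰-1 ()

  module Excess4 {n} (G : Graph (Fin n)) (e : ℕ) (K : ℤ) (7≤K : + 7 ≤ K)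
    (regular : ∀ u → Neighbours.nbrSum G (λ _ → 1ℤ) u ≡ K)
    (girth : HasGirth G (2 ℕ.* (2 ℕ.+ e)))
    (order : + n ≡ H K (suc e) K + H K (suc e) K + + 4)
    (far : ∀ v → ∑ (λ w → level (3 ℕ.+ e) (Distance.dist G (4 ℕ.+ e) (s≤s z≤n) w v)) ≡ + 2)
    where

    open LargeGirth G e K regular girth public

    private
      V = Fin n

      7≤K′ : 0ℤ ≤ K - + 7
      7≤K′ = i≤j⇒0≤j-i 7≤K

      data Level : ℕ → Set where
        near : ∀ {j} → j ℕ.< 2 ℕ.+ e → Level j
        at-d : Level (2 ℕ.+ e)
        at-d+1 : Level (3 ℕ.+ e)
        at-d+2 : Level (4 ℕ.+ e)

      levelOf : ∀ {j} → j ℕ.≤ 4 ℕ.+ e → Level j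
      levelOf le with ℕₚ.m≤n⇒m<n∨m≡n le
      ... | inj₂ refl = at-d+2
      ... | inj₁ lt with ℕₚ.m≤n⇒m<n∨m≡n (ℕₚ.≤-pred lt)
      ...   | inj₂ refl = at-d+1
      ...   | inj₁ lt′ with ℕₚ.m≤n⇒m<n∨m≡n (ℕₚ.≤-pred lt′)
      ...     | inj₂ refl = at-d
      ...     | inj₁ lt″ = near lt″

      m<2+m : ∀ m → m ℕ.< 2 ℕ.+ m
      m<2+m m = ℕₚ.m≤n+m (suc m) 1

      m<3+m : ∀ m → m ℕ.< 3 ℕ.+ m
      m<3+m m = ℕₚ.m≤n+m (suc m) 2

    on : ℕ → V → V → ℤ
    on m v u = level m (dist u v)

    0≤on : ∀ m v u → 0ℤ ≤ on m v u
    0≤on m v u = 0≤level m (dist u v)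

    -- γ v marks all vertices further than d + 1 from v, including the unreachable ones.
    α β γ : V → V → ℤ
    α = on (2 ℕ.+ e)
    β = on (3 ℕ.+ e)
    γ = on (4 ℕ.+ e)

    nbrSum-split₃ : ∀ {f g h : V → ℤ} {u} → (∀ w → Adj G u w → 1ℤ ≡ f w + (g w + h w)) →
      K ≡ nbrSum f u + (nbrSum g u + nbrSum h u)
    nbrSum-split₃ {f} {g} {h} {u} eq = begin
      K                                        ≡⟨ regular u ⟨
      nbrSum (λ _ → 1ℤ) u                      ≡⟨ nbrSum-cong eq ⟩
      nbrSum (λ w → f w + (g w + h w)) u       ≡⟨ nbrSum-+ f (λ w → g w + h w) u ⟩
      nbrSum f u + nbrSum (λ w → g w + h w) u  ≡⟨ cong (_+_ (nbrSum f u)) (nbrSum-+ g h u) ⟩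
      nbrSum f u + (nbrSum g u + nbrSum h u)   ∎
      where open ≡-Reasoning

    three-levels : ∀ {m v u} → dist u v ≡ suc m → ∀ w → Adj G u w →
      1ℤ ≡ on m v w + (on (suc m) v w + on (2 ℕ.+ m) v w)
    three-levels {m} {v} eu w a with dist w v | adj-levels v a eu
    ... | .m | inj₁ refl = sym (cong₂ _+_ (level-self m)
      (cong₂ _+_ (level-< (ℕₚ.n<1+n m)) (level-< (m<2+m m))))
    ... | .(suc m) | inj₂ (inj₁ refl) = sym (cong₂ _+_ (level-> (ℕₚ.n<1+n m))
      (cong₂ _+_ (level-self (suc m)) (level-< (ℕₚ.n<1+n (suc m)))))
    ... | .(2 ℕ.+ m) | inj₂ (inj₂ refl) = sym (cong₂ _+_ (level-> (m<2+m m))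
      (cong₂ _+_ (level-> (ℕₚ.n<1+n (suc m))) (level-self (2 ℕ.+ m))))

    degree-split : ∀ {m v u} → dist u v ≡ suc m →
      K ≡ nbrSum (on m v) u + (nbrSum (on (suc m) v) u + nbrSum (on (2 ℕ.+ m) v) u)
    degree-split eu = nbrSum-split₃ (three-levels eu)

    private
      ξ≡on : ∀ {v u} → dist u v ≡ 2 ℕ.+ e → ∀ w → Adj G u w → ξ (suc e) (dist w v) ≡ on (suc e) v w
      ξ≡on {v} eu w a with dist w v | adj-levels v a eu
      ... | _ | inj₁ refl = trans (ξ-self (suc e)) (sym (level-self (suc e)))
      ... | _ | inj₂ (inj₁ refl) = trans (ξ-vanish (ℕₚ.n<1+n (suc e))) (sym (level-> (ℕₚ.n<1+n (suc e))))
      ... | _ | inj₂ (inj₂ refl) = trans (ξ-vanish (m<2+m (suc e))) (sym (level-> (m<2+m (suc e))))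

      nbrSum-ξ-outer : ∀ {u v j} → dist u v ≡ suc j → 2 ℕ.+ e ℕ.≤ j →
        nbrSum (λ w → ξ (suc e) (dist w v)) u ≡ K * ξ e (dist u v) + α v u * (K - (nbrSum (α v) u + nbrSum (β v) u))
      nbrSum-ξ-outer {u} {v} {j} eu le = trans
        (nbrSum-outer (ξ (suc e)) eu (λ le′ → ξ-vanish (ℕₚ.≤-trans le le′)))
        (sym (cong₂ _+_
          (trans (cong (K *_) (trans (cong (ξ e) eu) (ξ-vanish (ℕₚ.≤-trans (ℕₚ.m≤n+m (suc e) 1) (ℕₚ.m≤n⇒m≤1+n le))))) (*-zeroʳ K))
          (cong (_* (K - (nbrSum (α v) u + nbrSum (β v) u)))
            (level-≢ λ eq → ℕₚ.<⇒≢ (s≤s le) (trans (sym eq) eu)))))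

      absorb : ∀ {j} x y → j ℕ.< 2 ℕ.+ e → x ≡ x + level (2 ℕ.+ e) j * y
      absorb x y lt = sym (trans (cong (λ z → x + z * y) (level-< lt)) (+-identityʳ x))

    -- The step beyond `nbrSum-ξ`. At level d a vertex may have several nearer neighbours; their
    -- number is `K` minus the neighbours on levels d and d + 1, which gives the correction term.
    nbrSum-ξ-top : ∀ u v → nbrSum (λ w → ξ (suc e) (dist w v)) u ≡
      K * ξ e (dist u v) + α v u * (K - (nbrSum (α v) u + nbrSum (β v) u))
    nbrSum-ξ-top u v with dist u v in eu | levelOf (dist≤N u v)
    ... | zero | near lt = trans (nbrSum-root (ξ (suc e)) eu) (trans (cong (K *_) (ξ-suc-suc e 0)) (absorb _ _ lt))
    ... | suc j | near (s≤s (s≤s lt)) = begin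
      nbrSum (λ w → ξ (suc e) (dist w v)) u  ≡⟨ nbrSum-inner (ξ (suc e)) eu (s≤s (s≤s lt)) ⟩
      ξ (suc e) j + (K - 1ℤ) * ξ (suc e) (2 ℕ.+ j)
        ≡⟨ cong₂ (λ x y → x + (K - 1ℤ) * y) (trans (ξ-skip (s≤s lt)) (ξ-suc-suc e (suc j))) (ξ-suc-suc e (suc j)) ⟩
      ξ e (suc j) + (K - 1ℤ) * ξ e (suc j)   ≡⟨ collect K (ξ e (suc j)) ⟩
      K * ξ e (suc j)                        ≡⟨ absorb _ X (s≤s (s≤s lt)) ⟩
      K * ξ e (suc j) + level (2 ℕ.+ e) (suc j) * X ∎
      where
      open ≡-Reasoning
      X = K - (nbrSum (α v) u + nbrSum (β v) u)
      collect : ∀ K x → x + (K - 1ℤ) * x ≡ K * x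
      collect = solve-∀
    ... | _ | at-d = begin
      nbrSum (λ w → ξ (suc e) (dist w v)) u  ≡⟨ nbrSum-cong (ξ≡on eu) ⟩
      nbrSum (on (suc e) v) u                ≡⟨ isolate (nbrSum (on (suc e) v) u) (nbrSum (α v) u + nbrSum (β v) u) ⟩
      nbrSum (on (suc e) v) u + Y - Y        ≡⟨ cong (_- Y) (sym (degree-split eu)) ⟩
      K - Y                                  ≡⟨ pad K (K - Y) ⟩
      K * 0ℤ + 1ℤ * (K - Y)                  ≡⟨ cong₂ (λ x y → K * x + y * (K - Y)) (ξ-vanish (m<2+m e)) (level-self (2 ℕ.+ e)) ⟨
      K * ξ e (2 ℕ.+ e) + level (2 ℕ.+ e) (2 ℕ.+ e) * (K - Y) ∎
      where
      open ≡-Reasoning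
      Y = nbrSum (α v) u + nbrSum (β v) u
      isolate : ∀ x y → x ≡ x + y - y
      isolate = solve-∀
      pad : ∀ K x → x ≡ K * 0ℤ + 1ℤ * x
      pad = solve-∀
    ... | _ | at-d+1 = subst (λ j → nbrSum (λ w → ξ (suc e) (dist w v)) u ≡
        K * ξ e j + level (2 ℕ.+ e) j * (K - (nbrSum (α v) u + nbrSum (β v) u))) eu
        (nbrSum-ξ-outer eu ℕₚ.≤-refl)
    ... | _ | at-d+2 = subst (λ j → nbrSum (λ w → ξ (suc e) (dist w v)) u ≡
        K * ξ e j + level (2 ℕ.+ e) j * (K - (nbrSum (α v) u + nbrSum (β v) u))) eu
        (nbrSum-ξ-outer eu (ℕₚ.n≤1+n _))

    all-levels : ∀ u v → 1ℤ ≡ ξ (suc e) (dist u v) + ξ e (dist u v) + (α v u + (β v u + γ v u))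
    all-levels u v with dist u v | levelOf (dist≤N u v)
    ... | j | near (s≤s lt) = sym (cong₂ _+_ (ξ-pair lt) (cong₂ _+_ (level-< (s≤s lt))
      (cong₂ _+_ (level-< (ℕₚ.m≤n⇒m≤1+n (s≤s lt))) (level-< (ℕₚ.m≤n⇒m≤1+n (ℕₚ.m≤n⇒m≤1+n (s≤s lt)))))))
    ... | _ | at-d = sym (cong₂ _+_ (cong₂ _+_ (ξ-vanish (ℕₚ.n<1+n (suc e))) (ξ-vanish (m<2+m e)))
      (cong₂ _+_ (level-self (2 ℕ.+ e)) (cong₂ _+_ (level-< (ℕₚ.n<1+n _)) (level-< (m<2+m _)))))
    ... | _ | at-d+1 = sym (cong₂ _+_ (cong₂ _+_ (ξ-vanish (m<2+m (suc e))) (ξ-vanish (m<3+m e)))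
      (cong₂ _+_ (level-> (ℕₚ.n<1+n _)) (cong₂ _+_ (level-self (3 ℕ.+ e)) (level-< (ℕₚ.n<1+n _)))))
    ... | _ | at-d+2 = sym (cong₂ _+_ (cong₂ _+_ (ξ-vanish (m<3+m (suc e))) (ξ-vanish (ℕₚ.m≤n+m (suc e) 3)))
      (cong₂ _+_ (level-> (m<2+m _)) (cong₂ _+_ (level-> (ℕₚ.n<1+n _)) (level-self (4 ℕ.+ e)))))

    private module At (v : V) where

      -- The unknowns of the edge count from `v`. The aim is `r` = 0 and `X` = `Z`, after which `Z`
      -- is bounded because level d + 1 has only two vertices.
      X Y Z r : ℤ
      X = edgeSum (α v) (α v)
      Y = edgeSum (α v) (β v)
      Z = edgeSum (β v) (β v)
      r = ∑ (γ v)

      order-by-levels : + n ≡ H K (suc e) K + H K e K + (∑ (α v) + (+ 2 + r))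
      order-by-levels = begin
        + n                ≡⟨ sum-one n ⟨
        ∑ {n} (λ _ → 1ℤ)   ≡⟨ ∑-cong (λ u → all-levels u v) ⟩
        ∑ (λ u → ξ (suc e) (dist u v) + ξ e (dist u v) + (α v u + (β v u + γ v u)))
          ≡⟨ ∑-distrib-+ (λ u → ξ (suc e) (dist u v) + ξ e (dist u v)) (λ u → α v u + (β v u + γ v u)) ⟩
        ∑ (λ u → ξ (suc e) (dist u v) + ξ e (dist u v)) + ∑ (λ u → α v u + (β v u + γ v u))
          ≡⟨ cong₂ _+_ (∑-distrib-+ (λ u → ξ (suc e) (dist u v)) (λ u → ξ e (dist u v)))
               (trans (∑-distrib-+ (α v) (λ u → β v u + γ v u)) (cong (_+_ (∑ (α v))) (∑-distrib-+ (β v) (γ v)))) ⟩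
        ∑ (λ u → ξ (suc e) (dist u v)) + ∑ (λ u → ξ e (dist u v)) + (∑ (α v) + (∑ (β v) + r))
          ≡⟨ cong₂ _+_ (cong₂ _+_ (sum-ξ (suc e) ℕₚ.≤-refl v) (sum-ξ e (ℕₚ.n≤1+n e) v))
               (cong (λ x → ∑ (α v) + (x + r)) (far v)) ⟩
        H K (suc e) K + H K e K + (∑ (α v) + (+ 2 + r)) ∎
        where open ≡-Reasoning

      edges-to-α : K * H K (suc e) K ≡ K * H K e K + (K * ∑ (α v) + -1ℤ * (X + Y))
      edges-to-α = begin
        K * H K (suc e) K                               ≡⟨ cong (K *_) (sum-ξ (suc e) ℕₚ.≤-refl v) ⟨
        K * ∑ (λ u → ξ (suc e) (dist u v))              ≡⟨ sum-nbrSum (λ u → ξ (suc e) (dist u v)) ⟨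
        ∑ (nbrSum (λ u → ξ (suc e) (dist u v)))
          ≡⟨ ∑-cong (λ u → trans (nbrSum-ξ-top u v) (expand K (ξ e (dist u v)) (α v u) (nbrSum (α v) u) (nbrSum (β v) u))) ⟩
        ∑ (λ u → K * ξ e (dist u v) + (K * α v u + -1ℤ * xy u))
          ≡⟨ ∑-distrib-+ (λ u → K * ξ e (dist u v)) (λ u → K * α v u + -1ℤ * xy u) ⟩
        ∑ (λ u → K * ξ e (dist u v)) + ∑ (λ u → K * α v u + -1ℤ * xy u)
          ≡⟨ cong₂ _+_ (trans (sum-*ˡ K (λ u → ξ e (dist u v))) (cong (K *_) (sum-ξ e (ℕₚ.n≤1+n e) v)))
               (∑-distrib-+ (λ u → K * α v u) (λ u → -1ℤ * xy u)) ⟩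
        K * H K e K + (∑ (λ u → K * α v u) + ∑ (λ u → -1ℤ * xy u))
          ≡⟨ cong₂ (λ x y → K * H K e K + (x + y)) (sum-*ˡ K (α v)) (sum-*ˡ -1ℤ xy) ⟩
        K * H K e K + (K * ∑ (α v) + -1ℤ * ∑ xy)
          ≡⟨ cong (λ x → K * H K e K + (K * ∑ (α v) + -1ℤ * x)) (trans
               (∑-distrib-+ (λ u → α v u * nbrSum (α v) u) (λ u → α v u * nbrSum (β v) u))
               (sym (cong₂ _+_ (edgeSum-def (α v) (α v)) (edgeSum-def (α v) (β v))))) ⟩
        K * H K e K + (K * ∑ (α v) + -1ℤ * (X + Y)) ∎
        where
        open ≡-Reasoning
        xy : V → ℤ
        xy u = α v u * nbrSum (α v) u + α v u * nbrSum (β v) u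
        expand : ∀ K p a x y → K * p + a * (K - (x + y)) ≡ K * p + (K * a + -1ℤ * (a * x + a * y))
        expand = solve-∀

      -- Eliminate the size of level d between `order-by-levels` and `edges-to-α`. Excess 4 less the
      -- two vertices at distance d + 1 leaves the constant 2.
      X+Y≡ : X + Y ≡ K * (+ 2 - r)
      X+Y≡ = begin
        X + Y ≡⟨ p K X Y h₀ h₁ s ⟩
        h₀-part - (h₀-part + -1ℤ * (X + Y)) ≡⟨ cong (_-_ h₀-part) (trans (reassoc (K * h₀) (K * s) (X + Y)) (sym edges-to-α)) ⟩
        h₀-part - K * h₁                    ≡⟨ q K h₀ h₁ s r ⟩
        K * (h₁ + h₀ + (s + (+ 2 + r)) - (h₁ + h₁ + + 4) + (+ 2 - r)) ≡⟨ cong (λ x → K * (x - (h₁ + h₁ + + 4) + (+ 2 - r))) (trans (sym order-by-levels) order) ⟩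
        K * (h₁ + h₁ + + 4 - (h₁ + h₁ + + 4) + (+ 2 - r)) ≡⟨ z K (h₁ + h₁ + + 4) (+ 2 - r) ⟩
        K * (+ 2 - r) ∎
        where
        open ≡-Reasoning
        h₀ = H K e K
        h₁ = H K (suc e) K
        s = ∑ (α v)
        h₀-part = K * h₀ + K * s
        p : ∀ K X Y h₀ h₁ s → X + Y ≡ K * h₀ + K * s - (K * h₀ + K * s + -1ℤ * (X + Y))
        p = solve-∀
        reassoc : ∀ a b c → a + b + -1ℤ * c ≡ a + (b + -1ℤ * c)
        reassoc = solve-∀
        q : ∀ K h₀ h₁ s r → K * h₀ + K * s - K * h₁ ≡ K * (h₁ + h₀ + (s + (+ 2 + r)) - (h₁ + h₁ + + 4) + (+ 2 - r))
        q = solve-∀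
        z : ∀ K m x → K * (m - m + x) ≡ K * x
        z = solve-∀

      edgeSum-split : ∀ m → K * ∑ (on (suc m) v) ≡
        edgeSum (on (suc m) v) (on m v) + (edgeSum (on (suc m) v) (on (suc m) v) + edgeSum (on (suc m) v) (on (2 ℕ.+ m) v))
      edgeSum-split m = begin
        K * ∑ f                       ≡⟨ trans (*-comm K (∑ f)) (sym (sum-*ʳ K f)) ⟩
        ∑ (λ u → f u * K)             ≡⟨ ∑-cong (λ u → level-guard (degree-split {m})) ⟩
        ∑ (λ u → f u * (nbrSum (on m v) u + (nbrSum f u + nbrSum (on (2 ℕ.+ m) v) u)))
          ≡⟨ ∑-cong (λ u → expand (f u) (nbrSum (on m v) u) (nbrSum f u) (nbrSum (on (2 ℕ.+ m) v) u)) ⟩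
        ∑ (λ u → f u * nbrSum (on m v) u + (f u * nbrSum f u + f u * nbrSum (on (2 ℕ.+ m) v) u))
          ≡⟨ trans (∑-distrib-+ (λ u → f u * nbrSum (on m v) u) (λ u → f u * nbrSum f u + f u * nbrSum (on (2 ℕ.+ m) v) u))
               (cong (_+_ (∑ (λ u → f u * nbrSum (on m v) u))) (∑-distrib-+ (λ u → f u * nbrSum f u) (λ u → f u * nbrSum (on (2 ℕ.+ m) v) u))) ⟩
        ∑ (λ u → f u * nbrSum (on m v) u) + (∑ (λ u → f u * nbrSum f u) + ∑ (λ u → f u * nbrSum (on (2 ℕ.+ m) v) u))
          ≡⟨ cong₂ _+_ (edgeSum-def f (on m v)) (cong₂ _+_ (edgeSum-def f f) (edgeSum-def f (on (2 ℕ.+ m) v))) ⟨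
        edgeSum f (on m v) + (edgeSum f f + edgeSum f (on (2 ℕ.+ m) v)) ∎
        where
        open ≡-Reasoning
        f = on (suc m) v
        expand : ∀ a x y z → a * (x + (y + z)) ≡ a * x + (a * y + a * z)
        expand = solve-∀

      0≤X : 0ℤ ≤ X
      0≤X = 0≤edgeSum (0≤on _ v) (0≤on _ v)

      -- Each of the two vertices at distance d + 1 has a parent on level d.
      2≤Y : + 2 ≤ Y
      2≤Y = begin
        + 2                               ≡⟨ far v ⟨
        ∑ (β v)                           ≡⟨ ∑-cong (λ u → sym (*-identityʳ (β v u))) ⟩
        ∑ (λ u → β v u * 1ℤ)              ≤⟨ sum-mono-≤ (λ u → level-guard-≤ has-parent) ⟩
        ∑ (λ u → β v u * nbrSum (α v) u)  ≡⟨ edgeSum-def (β v) (α v) ⟨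
        edgeSum (β v) (α v)               ≡⟨ edgeSum-sym (β v) (α v) ⟩
        Y                                 ∎
        where
        open ≤-Reasoning
        has-parent : ∀ {u} → dist u v ≡ 3 ℕ.+ e → 1ℤ ≤ nbrSum (α v) u
        has-parent eu with parent eu ℕₚ.≤-refl
        ... | p , a , ep = subst (_≤ nbrSum (α v) _) (trans (cong (level (2 ℕ.+ e)) ep) (level-self (2 ℕ.+ e)))
          (term≤nbrSum (0≤on _ v) a)

      -- The cap d + 2 makes level d + 3 empty, so `edgeSum-split` also applies at the last level.
      no-level-5 : edgeSum (γ v) (on (5 ℕ.+ e) v) ≡ 0ℤ
      no-level-5 = trans (edgeSum-def (γ v) (on (5 ℕ.+ e) v)) (trans (∑-cong vanish) (sum-zero n))
        where
        vanish : ∀ u → γ v u * nbrSum (on (5 ℕ.+ e) v) u ≡ 0ℤ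
        vanish u = trans (cong (γ v u *_) (trans
          (nbrSum-cong (λ w _ → level-< (s≤s (dist≤N w v)))) (trans (nbrSum-const 0ℤ u) (*-zeroʳ K))))
          (*-zeroʳ (γ v u))

      Kr≡ : K * r ≡ edgeSum (γ v) (β v) + (edgeSum (γ v) (γ v) + 0ℤ)
      Kr≡ = trans (edgeSum-split (3 ℕ.+ e))
        (cong (λ x → edgeSum (γ v) (β v) + (edgeSum (γ v) (γ v) + x)) no-level-5)

      0≤r : 0ℤ ≤ r
      0≤r = 0≤sum (0≤on _ v)

      -- Otherwise `X+Y≡` makes `X` + `Y` nonpositive, against `2≤Y`. The contradiction is a sum of
      -- nonnegative terms equal to -2.
      r≱2 : ¬ (+ 2 ≤ r)
      r≱2 2≤r = contradiction (subst (0ℤ ≤_) eq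
        (0≤+ (0≤+ 0≤X (i≤j⇒0≤j-i 2≤Y)) (0≤* {K} (≤-trans (+≤+ z≤n) 7≤K) (i≤j⇒0≤j-i 2≤r)))) λ ()
        where
        open ≡-Reasoning
        regroup : ∀ X Y z → X + (Y - + 2) + z ≡ X + Y + z - + 2
        regroup = solve-∀
        cancel : ∀ K r → K * (+ 2 - r) + K * (r - + 2) - + 2 ≡ -[1+ 1 ]
        cancel = solve-∀
        eq : X + (Y - + 2) + K * (r - + 2) ≡ -[1+ 1 ]
        eq = begin
          X + (Y - + 2) + K * (r - + 2)           ≡⟨ regroup X Y (K * (r - + 2)) ⟩
          X + Y + K * (r - + 2) - + 2             ≡⟨ cong (λ x → x + K * (r - + 2) - + 2) X+Y≡ ⟩
          K * (+ 2 - r) + K * (r - + 2) - + 2     ≡⟨ cancel K r ⟩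
          -[1+ 1 ]                                ∎

      -- A single vertex beyond level d + 1 could only be adjacent to the two vertices of level d +
      -- 1, so its degree `K` would be at most 2.
      r≢1 : r ≢ 1ℤ
      r≢1 r≡1 = contradiction (subst (0ℤ ≤_) eq
        (0≤+ (0≤+ (i≤j⇒0≤j-i (edgeSum≤sum*sum (0≤on _ v) (0≤on _ v)))
                  (i≤j⇒0≤j-i (Indicator.edgeSum-self≤ (0≤on _ v) (λ u → level-idem _ (dist u v))))) 7≤K′)) λ ()
        where
        open ≡-Reasoning
        A = edgeSum (γ v) (β v)
        B = edgeSum (γ v) (γ v)
        regroup : ∀ r s A B K → (r * s - A) + (r * r - r - B) + (K - + 7) ≡ r * s + r * r - r + K - + 7 - (A + (B + 0ℤ))
        regroup = solve-∀
        cancel : ∀ K → 1ℤ * + 2 + 1ℤ * 1ℤ - 1ℤ + K - + 7 - K * 1ℤ ≡ -[1+ 4 ]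
        cancel = solve-∀
        eq : (r * ∑ (β v) - A) + (r * r - r - B) + (K - + 7) ≡ -[1+ 4 ]
        eq = begin
          (r * ∑ (β v) - A) + (r * r - r - B) + (K - + 7)  ≡⟨ regroup r (∑ (β v)) A B K ⟩
          r * ∑ (β v) + r * r - r + K - + 7 - (A + (B + 0ℤ))
            ≡⟨ cong₂ (λ x y → r * x + r * r - r + K - + 7 - y) (far v) (sym Kr≡) ⟩
          r * + 2 + r * r - r + K - + 7 - K * r            ≡⟨ cong (λ x → x * + 2 + x * x - x + K - + 7 - K * x) r≡1 ⟩
          1ℤ * + 2 + 1ℤ * 1ℤ - 1ℤ + K - + 7 - K * 1ℤ       ≡⟨ cancel K ⟩
          -[1+ 4 ]                                         ∎

      r≡0 : r ≡ 0ℤ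
      r≡0 with r | 0≤r | r≱2 | r≢1
      ... | + 0 | _ | _ | _ = refl
      ... | + 1 | _ | _ | ≢1 = ⊥-elim (≢1 refl)
      ... | + suc (suc _) | _ | ≱2 | _ = ⊥-elim (≱2 (+≤+ (s≤s (s≤s z≤n))))

      -- With `r` = 0, `X` + `Y` is 2`K`. The degrees of the two vertices of level d + 1 also sum to
      -- 2`K`, and their edges are counted by `Y` + `Z`.
      X≡Z : X ≡ Z
      X≡Z = begin
        X                        ≡⟨ isolate X Y ⟩
        X + Y - Y                ≡⟨ cong (_- Y) (trans X+Y≡ (cong (λ x → K * (+ 2 - x)) r≡0)) ⟩
        K * + 2 - Y              ≡⟨ cong (λ x → K * x - Y) (far v) ⟨
        K * ∑ (β v) - Y          ≡⟨ cong₂ (λ x y → x - y) (edgeSum-split (2 ℕ.+ e)) (edgeSum-sym (α v) (β v)) ⟩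
        P + (Z + Q) - P          ≡⟨ cong (λ x → P + (Z + x) - P) Q≡0 ⟩
        P + (Z + 0ℤ) - P         ≡⟨ drop P Z ⟩
        Z                        ∎
        where
        open ≡-Reasoning
        P = edgeSum (β v) (α v)
        Q = edgeSum (β v) (γ v)
        isolate : ∀ x y → x ≡ x + y - y
        isolate = solve-∀
        drop : ∀ p z → p + (z + 0ℤ) - p ≡ z
        drop = solve-∀
        Q≡0 : Q ≡ 0ℤ
        Q≡0 = ≤-antisym
          (subst (Q ≤_) (trans (cong (∑ (β v) *_) r≡0) (*-zeroʳ (∑ (β v)))) (edgeSum≤sum*sum (0≤on _ v) (0≤on _ v)))
          (0≤edgeSum (0≤on _ v) (0≤on _ v))

      X≤2 : X ≤ + 2
      X≤2 = subst₂ _≤_ (sym X≡Z) (cong (λ s → s * s - s) (far v))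
        (Indicator.edgeSum-self≤ (0≤on _ v) (λ u → level-idem _ (dist u v)))

    dist≤d+1 : ∀ u v → dist u v ℕ.≤ 3 ℕ.+ e
    dist≤d+1 u v with ℕₚ.m≤n⇒m<n∨m≡n (dist≤N u v)
    ... | inj₁ lt = ℕₚ.≤-pred lt
    ... | inj₂ eq = contradiction
      (trans (sym (level-self (4 ℕ.+ e))) (trans (cong (level (4 ℕ.+ e)) (sym eq)) (sum≡0⇒term≡0 (0≤on _ v) (At.r≡0 v) u)))
      λ ()

    -- A neighbour of t cannot be at distance d − 1 from both ends z₁, z₂ of the edge, whereas
    -- at least k − 3 neighbours of t are at distance d − 1 from each of them.
    no-edge-at-d : ∀ {t z₁ z₂} → Adj G z₁ z₂ → dist t z₁ ≡ 2 ℕ.+ e → dist t z₂ ≡ 2 ℕ.+ e → ⊥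
    no-edge-at-d {t} {z₁} {z₂} a e₁ e₂ = 0≰-1 (subst (0ℤ ≤_) total
      (0≤+ (0≤+ (0≤+ (few-at-d e₁) (few-at-d+1 z₁)) (0≤+ (0≤+ (few-at-d e₂) (few-at-d+1 z₂)) (i≤j⇒0≤j-i disjoint)))
        (0≤+ 7≤K′ ≤-refl)))
      where
      b m c : V → ℤ
      b z = nbrSum (on (suc e) z) t
      m z = nbrSum (α z) t
      c z = nbrSum (β z) t
      -- By `At.X≤2` level d around `z` contains at most one edge, so `t` has at most one neighbour
      -- there.
      few-at-d : ∀ {z} → dist t z ≡ 2 ℕ.+ e → 0ℤ ≤ 1ℤ - m z
      few-at-d {z} ez = i≤j⇒0≤j-i (half (m z) (≤-trans
        (Indicator.2nbrSum≤edgeSum (0≤on _ z) (λ u → level-idem _ (dist u z)) t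
          (trans (cong (level _) ez) (level-self _)))
        (At.X≤2 z)))
        where
        half : ∀ x → x + x ≤ + 2 → x ≤ 1ℤ
        half (+ 0) _ = +≤+ z≤n
        half (+ 1) _ = ≤-refl
        half (+ suc (suc x)) (+≤+ (s≤s (s≤s le))) =
          contradiction (ℕₚ.≤-trans (ℕₚ.≤-reflexive (sym (ℕₚ.+-suc x (suc x)))) le) λ ()
        half -[1+ _ ] _ = -≤+
      few-at-d+1 : ∀ z → 0ℤ ≤ + 2 - c z
      few-at-d+1 z = i≤j⇒0≤j-i (subst (c z ≤_) (far z) (nbrSum≤sum (0≤on _ z)))
      not-both : ∀ w → Adj G t w → on (suc e) z₁ w + on (suc e) z₂ w ≤ 1ℤ
      not-both w aw with dist w z₁ ℕ.≟ suc e | dist w z₂ ℕ.≟ suc e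
      ... | yes e₁ | yes e₂ = ⊥-elim (no-level-edge a (trans (dist-sym z₁ w) e₁) (trans (dist-sym z₂ w) e₂) ℕₚ.≤-refl)
      ... | no ≢₁ | _ = ≤-trans (≤-reflexive (trans (cong (_+ on (suc e) z₂ w) (level-≢ ≢₁)) (+-identityˡ _))) (level≤1 _ _)
      ... | yes _ | no ≢₂ = ≤-trans (≤-reflexive (trans (cong (_+_ (on (suc e) z₁ w)) (level-≢ ≢₂)) (+-identityʳ _))) (level≤1 _ _)
      disjoint : b z₁ + b z₂ ≤ K
      disjoint = subst₂ _≤_ (nbrSum-+ (on (suc e) z₁) (on (suc e) z₂) t) (regular t) (nbrSum-mono not-both)
      ring : ∀ b₁ m₁ c₁ b₂ m₂ c₂ K → (1ℤ - m₁ + (+ 2 - c₁)) + ((1ℤ - m₂ + (+ 2 - c₂)) + (K - (b₁ + b₂))) + (K - + 7 + 0ℤ)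
        ≡ K + K - (b₁ + (m₁ + c₁)) - (b₂ + (m₂ + c₂)) - 1ℤ
      ring = solve-∀
      cancel : ∀ K → K + K - K - K - 1ℤ ≡ -1ℤ
      cancel = solve-∀
      -- Each `b` is at least `K` - 3 and their sum is at most `K`, so `K` would be at most 6. The
      -- nonnegative slacks add up to -1.
      total : (1ℤ - m z₁ + (+ 2 - c z₁)) + ((1ℤ - m z₂ + (+ 2 - c z₂)) + (K - (b z₁ + b z₂))) + (K - + 7 + 0ℤ) ≡ -1ℤ
      total = trans (ring (b z₁) (m z₁) (c z₁) (b z₂) (m z₂) (c z₂) K)
        (trans (cong₂ (λ x y → K + K - x - y - 1ℤ) (sym (degree-split e₁)) (sym (degree-split e₂))) (cancel K))

    -- `no-edge-at-d` gives `X` = 0, and `X≡Z` carries this from level d to level d + 1.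
    no-edge-at-d+1 : ∀ {u w v} → Adj G u w → dist u v ≡ 3 ℕ.+ e → dist w v ≡ 3 ℕ.+ e → ⊥
    no-edge-at-d+1 {u} {w} {v} a eu ew = contradiction
      (subst₂ _≤_ (on-yes ew) nbrs≡0 (term≤nbrSum (0≤on _ v) a)) λ { (+≤+ ()) }
      where
      on-yes : ∀ {m u} → dist u v ≡ m → on m v u ≡ 1ℤ
      on-yes {m} eu = trans (cong (level m) eu) (level-self m)
      isolated : ∀ u → α v u * nbrSum (α v) u ≡ 0ℤ
      isolated u = trans (level-guard λ eu → trans
        (nbrSum-cong λ w a → level-≢ λ ew → no-edge-at-d a (trans (dist-sym v u) eu) (trans (dist-sym v w) ew))
        (trans (nbrSum-const 0ℤ u) (*-zeroʳ K))) (*-zeroʳ (α v u))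
      Z≡0 : ∑ (λ u → β v u * nbrSum (β v) u) ≡ 0ℤ
      Z≡0 = trans (sym (edgeSum-def (β v) (β v))) (trans (sym (At.X≡Z v))
        (trans (edgeSum-def (α v) (α v)) (trans (∑-cong isolated) (sum-zero n))))
      nbrs≡0 : nbrSum (β v) u ≡ 0ℤ
      nbrs≡0 = trans (sym (*-identityˡ _)) (trans (cong (_* nbrSum (β v) u) (sym (on-yes eu)))
        (sum≡0⇒term≡0 (λ u → 0≤* (0≤on _ v u) (0≤nbrSum (0≤on _ v))) Z≡0 u))

    adj⇒dist≢ : ∀ {u w v j} → Adj G u w → dist u v ≡ j → dist w v ≡ j → ⊥
    adj⇒dist≢ {u} {v = v} {j} a eu ew with ℕₚ.m≤n⇒m<n∨m≡n (subst (ℕ._≤ 3 ℕ.+ e) eu (dist≤d+1 u v))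
    ... | inj₂ refl = no-edge-at-d+1 a eu ew
    ... | inj₁ lt with ℕₚ.m≤n⇒m<n∨m≡n (ℕₚ.≤-pred lt)
    ...   | inj₂ refl = no-edge-at-d a (trans (dist-sym v _) eu) (trans (dist-sym v _) ew)
    ...   | inj₁ lt′ = no-level-edge a eu ew lt′

    odd-flip : ∀ {u w} v → Adj G u w → odd (dist w v) ≡ 1ℤ - odd (dist u v)
    odd-flip {u} {w} v a with dist u v in eu
    ... | zero with dist w v in ew | subst (λ m → dist w v ℕ.≤ suc m) eu (dist-step v (adj-sym G a))
    ...   | 0 | _ = ⊥-elim (adj⇒dist≢ a eu ew)
    ...   | 1 | _ = refl
    ...   | suc (suc _) | s≤s ()
    odd-flip {u} {w} v a | suc j with adj-levels v a eu
    ... | inj₁ ew = trans (cong odd ew) (sym (odd-suc-suc j))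
    ... | inj₂ (inj₁ ew) = ⊥-elim (adj⇒dist≢ a eu ew)
    ... | inj₂ (inj₂ ew) = cong odd ew

  -- Cycles and their disjoint unions.

  record TwoNeighbours {V : Set} (H : Graph V) (u : V) : Set where
    field
      {s t} : V
      s≢t   : s ≢ t
      adj-s : Adj H u s
      adj-t : Adj H u t
      only  : ∀ {w} → Adj H u w → w ≡ s ⊎ w ≡ t

  succ-unique : ∀ {m} {i j j′ : Fin m} → CyclicSucc i j → CyclicSucc i j′ → j ≡ j′
  succ-unique (inj₁ e) (inj₁ e′) = toℕ-injective (trans (sym e) e′)
  succ-unique (inj₂ (_ , z)) (inj₂ (_ , z′)) = toℕ-injective (trans z (sym z′))
  succ-unique {j = j} (inj₁ e) (inj₂ (m , _)) = contradiction (trans (sym e) m) (ℕₚ.<⇒≢ (toℕ<n j))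
  succ-unique {j′ = j′} (inj₂ (m , _)) (inj₁ e) = contradiction (trans (sym e) m) (ℕₚ.<⇒≢ (toℕ<n j′))

  pred-unique : ∀ {m} {i i′ j : Fin m} → CyclicSucc i j → CyclicSucc i′ j → i ≡ i′
  pred-unique (inj₁ e) (inj₁ e′) = toℕ-injective (ℕₚ.suc-injective (trans e (sym e′)))
  pred-unique (inj₂ (m , _)) (inj₂ (m′ , _)) = toℕ-injective (ℕₚ.suc-injective (trans m (sym m′)))
  pred-unique (inj₁ e) (inj₂ (_ , z)) = contradiction (trans e z) λ ()
  pred-unique (inj₂ (_ , z)) (inj₁ e) = contradiction (trans e z) λ ()

  cyclicSuccessor : ∀ {m} (i : Fin (suc m)) → ∃[ j ] CyclicSucc i j
  cyclicSuccessor {m} i with ℕₚ.m≤n⇒m<n∨m≡n (ℕₚ.≤-pred (toℕ<n i))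
  ... | inj₁ lt = fromℕ< (s≤s lt) , inj₁ (sym (toℕ-fromℕ< (s≤s lt)))
  ... | inj₂ eq = fzero , inj₂ (cong suc eq , refl)

  cyclicPredecessor : ∀ {m} (i : Fin (suc m)) → ∃[ j ] CyclicSucc j i
  cyclicPredecessor {m} fzero = fromℕ m , inj₂ (cong suc (toℕ-fromℕ m) , refl)
  cyclicPredecessor (fsuc i)  = inject₁ i , inj₁ (cong suc (toℕ-inject₁ i))

  -- Makes successor and predecessor distinct neighbours; modulo 2 they would coincide.
  cyclicSucc-asym : ∀ {m} {i j : Fin m} → 3 ℕ.≤ m → CyclicSucc i j → ¬ CyclicSucc j i
  cyclicSucc-asym _ (inj₁ e) (inj₁ e′) = contradiction (trans (cong suc e) e′) λ eq → ℕₚ.m≢1+n+m _ (sym eq)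
  cyclicSucc-asym 3≤m (inj₁ e) (inj₂ (m , z)) = ℕₚ.<⇒≢ 3≤m (trans (cong suc (trans (cong suc (sym z)) e)) m)
  cyclicSucc-asym 3≤m (inj₂ (m , z)) (inj₁ e) = ℕₚ.<⇒≢ 3≤m (trans (cong suc (trans (cong suc (sym z)) e)) m)
  cyclicSucc-asym 3≤m (inj₂ (m , z)) (inj₂ (m′ , z′)) =
    ℕₚ.<⇒≢ (ℕₚ.≤-trans (s≤s (s≤s z≤n)) 3≤m) (trans (cong suc (sym z′)) m)

  cycle-twoNeighbours : ∀ {m} (3≤m : 3 ℕ.≤ m) i → TwoNeighbours (cycleGraph m 3≤m) i
  cycle-twoNeighbours {suc m} 3≤m i with cyclicSuccessor i | cyclicPredecessor i
  ... | s , is | p , pi = record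
    { s≢t = λ { refl → cyclicSucc-asym 3≤m is pi } ; adj-s = inj₁ is ; adj-t = inj₂ pi
    ; only = λ { (inj₁ iw) → inj₁ (succ-unique iw is) ; (inj₂ wi) → inj₂ (pred-unique wi pi) } }

  cycle-connected : ∀ {m} {A : Set} (f : Fin (suc m) → A) →
    (∀ {i j} → CyclicSucc i j → f i ≡ f j) → ∀ i → f i ≡ f fzero
  cycle-connected f h = <-weakInduction (λ i → f i ≡ f fzero) refl
    λ i eq → trans (sym (h (inj₁ (cong suc (toℕ-inject₁ i))))) eq

  ⊎ᴳ-twoNeighbours : ∀ {V W} {G : Graph V} {H : Graph W} →
    (∀ v → TwoNeighbours G v) → (∀ w → TwoNeighbours H w) → ∀ x → TwoNeighbours (G ⊎ᴳ H) x
  ⊎ᴳ-twoNeighbours two two′ (inj₁ v) = record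
    { s≢t = s≢t ∘ inj₁-injective ; adj-s = adj-s ; adj-t = adj-t
    ; only = λ { {inj₁ w} a → Data.Sum.map (cong inj₁) (cong inj₁) (only a) } }
    where open TwoNeighbours (two v)
  ⊎ᴳ-twoNeighbours two two′ (inj₂ v) = record
    { s≢t = s≢t ∘ inj₂-injective ; adj-s = adj-s ; adj-t = adj-t
    ; only = λ { {inj₂ w} a → Data.Sum.map (cong inj₂) (cong inj₂) (only a) } }
    where open TwoNeighbours (two′ v)

  ≅-twoNeighbours : ∀ {V W} {G : Graph V} {H : Graph W} → G ≅ H →
    (∀ w → TwoNeighbours H w) → ∀ v → TwoNeighbours G v
  ≅-twoNeighbours {G = G} {H} iso two v = record
    { s≢t = λ eq → s≢t (trans (sym (to∘from s)) (trans (cong to eq) (to∘from t)))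
    ; adj-s = back adj-s ; adj-t = back adj-t
    ; only = λ {w} a → Data.Sum.map (λ eq → trans (sym (from∘to w)) (cong from eq))
        (λ eq → trans (sym (from∘to w)) (cong from eq)) (only (Equivalence.to (adj-⇔ v w) a)) }
    where
    open _≅_ iso
    open Inverse bijection using (to; from)
    open TwoNeighbours (two (to v))
    to∘from : ∀ x → to (from x) ≡ x
    to∘from x = Inverse.strictlyInverseˡ bijection x
    from∘to : ∀ x → from (to x) ≡ x
    from∘to x = Inverse.strictlyInverseʳ bijection x
    back : ∀ {x} → Adj H (to v) x → Adj G v (from x)
    back {x} a = Equivalence.from (adj-⇔ v (from x)) (subst (Adj H (to v)) (sym (to∘from x)) a)

  twoNeighbours⇒degree-2 : ∀ {n} (H : Graph (Fin n)) {u} → TwoNeighbours H u →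
    Neighbours.nbrSum H (λ _ → 1ℤ) u ≡ + 2
  twoNeighbours⇒degree-2 H {u} two = begin
    nbrSum (λ _ → 1ℤ) u                                         ≡⟨ nbrSum-cong at ⟩
    nbrSum (λ w → 𝟙 (s ≟ w) * 1ℤ + 𝟙 (t ≟ w) * 1ℤ) u            ≡⟨ nbrSum-+ (λ w → 𝟙 (s ≟ w) * 1ℤ) (λ w → 𝟙 (t ≟ w) * 1ℤ) u ⟩
    nbrSum (λ w → 𝟙 (s ≟ w) * 1ℤ) u + nbrSum (λ w → 𝟙 (t ≟ w) * 1ℤ) u ≡⟨ cong₂ _+_ (nbrSum-at 1ℤ adj-s) (nbrSum-at 1ℤ adj-t) ⟩
    + 2 ∎
    where
    open ≡-Reasoning
    open Neighbours H
    open TwoNeighbours two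
    at : ∀ w → Adj H u w → 1ℤ ≡ 𝟙 (s ≟ w) * 1ℤ + 𝟙 (t ≟ w) * 1ℤ
    at w a with s ≟ w | t ≟ w
    ... | yes refl | yes refl = ⊥-elim (s≢t refl)
    ... | yes _    | no _     = refl
    ... | no _     | yes _    = refl
    ... | no s≢w   | no t≢w with only a
    ...   | inj₁ w≡s = ⊥-elim (s≢w (sym w≡s))
    ...   | inj₂ w≡t = ⊥-elim (t≢w (sym w≡t))

  -- h is the indicator of one of the two components; u₀ and u₁ represent them.
  record TwoComponents {V : Set} (H : Graph V) : Set where
    field
      h       : V → ℤ
      h-edge  : ∀ {u w} → Adj H u w → h u ≡ h w
      h-01    : ∀ u → h u ≡ 0ℤ ⊎ h u ≡ 1ℤ
      {u₀ u₁} : V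
      h-u₀    : h u₀ ≡ 0ℤ
      h-u₁    : h u₁ ≡ 1ℤ
      affine  : ∀ (f : V → ℤ) → (∀ {u w} → Adj H u w → f u ≡ f w) →
                ∀ u → f u ≡ (f u₁ - f u₀) * h u + f u₀

  twoCycles-components : ∀ {V} {H : Graph V} → IsUnionOfTwoCycles H → TwoComponents H
  twoCycles-components {V} {H} (suc a , suc b , 3≤a , 3≤b , iso) = record
    { h = side ∘ to
    ; h-edge = λ {u} {w} e → side-edge (to u) (to w) (Equivalence.to (adj-⇔ u w) e)
    ; h-01 = side-01 ∘ to
    ; h-u₀ = cong side (to∘from (inj₂ fzero)) ; h-u₁ = cong side (to∘from (inj₁ fzero))
    ; affine = λ f f-edge u → trans (cong f (sym (Inverse.strictlyInverseʳ bijection u)))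
        (affine′ f f-edge (to u)) }
    where
    open _≅_ iso
    open Inverse bijection using (to; from)
    C = cycleGraph (suc a) 3≤a ⊎ᴳ cycleGraph (suc b) 3≤b
    to∘from : ∀ x → to (from x) ≡ x
    to∘from x = Inverse.strictlyInverseˡ bijection x
    side : Fin (suc a) ⊎ Fin (suc b) → ℤ
    side (inj₁ _) = 1ℤ
    side (inj₂ _) = 0ℤ
    side-edge : ∀ x y → Adj C x y → side x ≡ side y
    side-edge (inj₁ _) (inj₁ _) _ = refl
    side-edge (inj₂ _) (inj₂ _) _ = refl
    side-01 : ∀ x → side x ≡ 0ℤ ⊎ side x ≡ 1ℤ
    side-01 (inj₁ _) = inj₂ refl
    side-01 (inj₂ _) = inj₁ refl
    module _ (f : V → ℤ) (f-edge : ∀ {u w} → Adj H u w → f u ≡ f w) where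
      edge : ∀ x y → Adj C x y → f (from x) ≡ f (from y)
      edge x y e = f-edge (Equivalence.from (adj-⇔ (from x) (from y))
        (subst₂ (Adj C) (sym (to∘from x)) (sym (to∘from y)) e))
      on-one : ∀ x y → x ≡ (x - y) * 1ℤ + y
      on-one = solve-∀
      on-zero : ∀ x y → y ≡ (x - y) * 0ℤ + y
      on-zero = solve-∀
      affine′ : ∀ x → f (from x) ≡ (f (from (inj₁ fzero)) - f (from (inj₂ fzero))) * side x + f (from (inj₂ fzero))
      affine′ (inj₁ i) = trans (cycle-connected (f ∘ from ∘ inj₁) (λ {i} {j} s → edge (inj₁ i) (inj₁ j) (inj₁ s)) i)
        (on-one (f (from (inj₁ fzero))) (f (from (inj₂ fzero))))
      affine′ (inj₂ i) = trans (cycle-connected (f ∘ from ∘ inj₂) (λ {i} {j} s → edge (inj₂ i) (inj₂ j) (inj₁ s)) i)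
        (on-zero (f (from (inj₁ fzero))) (f (from (inj₂ fzero))))

  -- The spectral argument.

  module Spectral {n} (G : Graph (Fin n)) (e : ℕ) (K : ℤ) (7≤K : + 7 ≤ K)
    (regular : ∀ u → Neighbours.nbrSum G (λ _ → 1ℤ) u ≡ K)
    (girth : HasGirth G (2 ℕ.* (2 ℕ.+ e)))
    (order : + n ≡ H K (suc e) K + H K (suc e) K + + 4)
    (far : ∀ v → ∑ (λ w → level (3 ℕ.+ e) (Distance.dist G (4 ℕ.+ e) (s≤s z≤n) w v)) ≡ + 2)
    (even-e : odd e ≡ 0ℤ) where

    open Excess4 G e K 7≤K regular girth order far

    private
      V = Fin n
      E = excessGraph (2 ℕ.+ e) G
      module E = Neighbours E

      odd-1+e : odd (1 ℕ.+ e) ≡ 1ℤ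
      odd-1+e = cong (_-_ 1ℤ) even-e

      odd-3+e : odd (3 ℕ.+ e) ≡ 1ℤ
      odd-3+e = trans (odd-suc-suc (suc e)) odd-1+e

    B : (V → ℤ) → V → ℤ
    B f u = ∑ (λ v → odd (dist u v) * f v)

    -- Here the evenness of d enters: the odd distances are those marked by `ξ` with the odd index d
    -- - 1, together with d + 1.
    odd≡ : ∀ u v → odd (dist u v) ≡ ξ (suc e) (dist u v) + level (3 ℕ.+ e) (dist u v)
    odd≡ u v with dist u v | dist≤d+1 u v
    ... | j | le with ℕₚ.m≤n⇒m<n∨m≡n le
    ...   | inj₂ refl = trans odd-3+e (sym (cong₂ _+_ (ξ-vanish (ℕₚ.m≤n+m (2 ℕ.+ e) 1)) (level-self (3 ℕ.+ e))))
    ...   | inj₁ lt with ℕₚ.m≤n⇒m<n∨m≡n (ℕₚ.≤-pred lt)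
    ...     | inj₂ refl = trans (trans (odd-suc-suc e) even-e)
      (sym (cong₂ _+_ (ξ-vanish (ℕₚ.n<1+n (suc e))) (level-< (ℕₚ.n<1+n (2 ℕ.+ e)))))
    ...     | inj₁ lt′ = sym (trans (cong₂ _+_ (ξ-odd (ℕₚ.≤-pred lt′) odd-1+e) (level-< lt)) (+-identityʳ _))

    E-sum : ∀ f u → E.nbrSum f u ≡ ∑ (λ v → level (3 ℕ.+ e) (dist u v) * f v)
    E-sum f u = trans (E.nbrSum-def f u) (∑-cong λ v → cong (_* f v)
      (sym (level-𝟙 (adj? E u v) (dist⇒hasDistance ℕₚ.≤-refl) (hasDistance⇒dist ℕₚ.≤-refl))))

    B≡T+E : ∀ f u → B f u ≡ T (suc e) f u + E.nbrSum f u
    B≡T+E f u = begin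
      ∑ (λ v → odd (dist u v) * f v)
        ≡⟨ ∑-cong (λ v → trans (cong (_* f v) (odd≡ u v)) (*-distribʳ-+ (f v) (ξ (suc e) (dist u v)) (level (3 ℕ.+ e) (dist u v)))) ⟩
      ∑ (λ v → ξ (suc e) (dist u v) * f v + level (3 ℕ.+ e) (dist u v) * f v)
        ≡⟨ ∑-distrib-+ (λ v → ξ (suc e) (dist u v) * f v) (λ v → level (3 ℕ.+ e) (dist u v) * f v) ⟩
      ∑ (λ v → ξ (suc e) (dist u v) * f v) + ∑ (λ v → level (3 ℕ.+ e) (dist u v) * f v)
        ≡⟨ cong₂ _+_ (T-kernel (suc e) ℕₚ.≤-refl f u) (E-sum f u) ⟨
      T (suc e) f u + E.nbrSum f u ∎
      where open ≡-Reasoning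

    nbrSum-odd : ∀ u v → nbrSum (λ w → odd (dist w v)) u ≡ K * (1ℤ - odd (dist u v))
    nbrSum-odd u v = trans (nbrSum-cong (λ w a → odd-flip v a)) (nbrSum-const (1ℤ - odd (dist u v)) u)

    private
      complement : ∀ f u → ∑ (λ v → K * (1ℤ - odd (dist u v)) * f v) ≡ K * (∑ f - B f u)
      complement f u = begin
        ∑ (λ v → K * (1ℤ - odd (dist u v)) * f v)               ≡⟨ ∑-cong (λ v → expand K (odd (dist u v)) (f v)) ⟩
        ∑ (λ v → K * f v + - K * (odd (dist u v) * f v))        ≡⟨ ∑-distrib-+ (λ v → K * f v) (λ v → - K * (odd (dist u v) * f v)) ⟩
        ∑ (λ v → K * f v) + ∑ (λ v → - K * (odd (dist u v) * f v)) ≡⟨ cong₂ _+_ (sum-*ˡ K f) (sum-*ˡ (- K) (λ v → odd (dist u v) * f v)) ⟩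
        K * ∑ f + - K * B f u                                   ≡⟨ collect K (∑ f) (B f u) ⟩
        K * (∑ f - B f u)                                       ∎
        where
        open ≡-Reasoning
        expand : ∀ K o x → K * (1ℤ - o) * x ≡ K * x + - K * (o * x)
        expand = solve-∀
        collect : ∀ K x y → K * x + - K * y ≡ K * (x - y)
        collect = solve-∀

    nbrSum-B : ∀ f u → nbrSum (B f) u ≡ K * (∑ f - B f u)
    nbrSum-B f u = trans (nbrSum-linear (λ w v → odd (dist w v)) f u)
      (trans (∑-cong λ v → cong (_* f v) (nbrSum-odd u v)) (complement f u))

    -- Both matrices are symmetric and so is their product, a combination of J and `B`; hence they
    -- commute.
    B-nbrSum : ∀ f u → B (nbrSum f) u ≡ nbrSum (B f) u
    B-nbrSum f u = begin
      ∑ (λ v → odd (dist u v) * nbrSum f v)                ≡⟨ edgeSum-def (λ v → odd (dist u v)) f ⟨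
      edgeSum (λ v → odd (dist u v)) f                     ≡⟨ edgeSum-sym (λ v → odd (dist u v)) f ⟩
      edgeSum f (λ v → odd (dist u v))                     ≡⟨ edgeSum-def f (λ v → odd (dist u v)) ⟩
      ∑ (λ v → f v * nbrSum (λ w → odd (dist u w)) v)      ≡⟨ ∑-cong at ⟩
      ∑ (λ v → K * (1ℤ - odd (dist u v)) * f v)            ≡⟨ complement f u ⟩
      K * (∑ f - B f u)                                    ≡⟨ nbrSum-B f u ⟨
      nbrSum (B f) u                                       ∎
      where
      open ≡-Reasoning
      at : ∀ v → f v * nbrSum (λ w → odd (dist u w)) v ≡ K * (1ℤ - odd (dist u v)) * f v
      at v = trans (*-comm (f v) _) (cong (_* f v) (trans
        (nbrSum-cong (λ w _ → cong odd (dist-sym u w)))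
        (trans (nbrSum-odd v u) (cong (λ j → K * (1ℤ - odd j)) (dist-sym v u)))))

    -- `E` is the difference of `B` and a polynomial in the adjacency matrix, and both commute with
    -- that matrix.
    E-nbrSum : ∀ f u → E.nbrSum (nbrSum f) u ≡ nbrSum (E.nbrSum f) u
    E-nbrSum f u = begin
      E.nbrSum (nbrSum f) u                                   ≡⟨ isolate (T (suc e) (nbrSum f) u) (E.nbrSum (nbrSum f) u) ⟩
      T (suc e) (nbrSum f) u + E.nbrSum (nbrSum f) u - T (suc e) (nbrSum f) u
        ≡⟨ cong₂ _-_ (trans (sym (B≡T+E (nbrSum f) u)) (B-nbrSum f u)) (T-nbrSum (suc e) f u) ⟩
      nbrSum (B f) u - nbrSum (T (suc e) f) u                 ≡⟨ nbrSum-- (B f) (T (suc e) f) u ⟨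
      nbrSum (λ w → B f w - T (suc e) f w) u
        ≡⟨ nbrSum-cong (λ w _ → trans (cong (_- T (suc e) f w) (B≡T+E f w)) (sym (isolate (T (suc e) f w) (E.nbrSum f w)))) ⟩
      nbrSum (E.nbrSum f) u                                   ∎
      where
      open ≡-Reasoning
      isolate : ∀ x y → y ≡ x + y - x
      isolate = solve-∀

    module _ (E-regular : ∀ u → E.nbrSum (λ _ → 1ℤ) u ≡ + 2) (comp : TwoComponents E)
      (H≢-2 : ∀ x → + 2 + H K (suc e) x ≢ 0ℤ) where

      open TwoComponents comp
      private
        module ER = E.RegularGraph (+ 2) E-regular

        E-h : ∀ u → E.nbrSum h u ≡ + 2 * h u
        E-h u = trans (E.nbrSum-cong (λ w a → sym (h-edge a))) (ER.nbrSum-const (h u) u)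

        -- By commutation `nbrSum h` is again a 2-eigenvector of `E`, that is, harmonic on a
        -- 2-regular graph.
        nbrSum-h-edge : ∀ {u w} → Adj E u w → nbrSum h u ≡ nbrSum h w
        nbrSum-h-edge = ER.harmonic⇒constant-on-edges (nbrSum h) λ u → trans (E-nbrSum h u)
          (trans (nbrSum-cong (λ w _ → E-h w)) (nbrSum-* (+ 2) h u))

      module Eigenvalue (θ q c : ℤ) (nbrSum-h : ∀ u → nbrSum h u ≡ θ * h u + q)
        (T-h : ∀ u → T (suc e) h u ≡ H K (suc e) θ * h u + c) where

        private
          μ : ℤ
          μ = + 2 + H K (suc e) θ

          B-h : ∀ u → B h u ≡ μ * h u + c
          B-h u = trans (B≡T+E h u) (trans (cong₂ _+_ (T-h u) (E-h u))
            (collect (H K (suc e) θ) (h u) c))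
            where
            collect : ∀ p x c → p * x + c + + 2 * x ≡ (+ 2 + p) * x + c
            collect = solve-∀

          nbrSum-B-h : ∀ u → μ * (θ * h u + q) + K * c ≡ K * (∑ h - (μ * h u + c))
          nbrSum-B-h u = begin
            μ * (θ * h u + q) + K * c               ≡⟨ cong₂ (λ x y → μ * x + y) (nbrSum-h u) (nbrSum-const c u) ⟨
            μ * nbrSum h u + nbrSum (λ _ → c) u     ≡⟨ cong (_+ nbrSum (λ _ → c) u) (nbrSum-* μ h u) ⟨
            nbrSum (λ w → μ * h w) u + nbrSum (λ _ → c) u ≡⟨ nbrSum-+ (λ w → μ * h w) (λ _ → c) u ⟨
            nbrSum (λ w → μ * h w + c) u            ≡⟨ nbrSum-cong (λ w _ → sym (B-h w)) ⟩
            nbrSum (B h) u                          ≡⟨ nbrSum-B h u ⟩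
            K * (∑ h - B h u)                       ≡⟨ cong (λ x → K * (∑ h - x)) (B-h u) ⟩
            K * (∑ h - (μ * h u + c))               ∎
            where open ≡-Reasoning

          μ[θ+K]≡0 : μ * (θ + K) ≡ 0ℤ
          μ[θ+K]≡0 = trans (difference μ θ q K c (∑ h)) (cong₂ _-_ (i≡j⇒i-j≡0 at₁) (i≡j⇒i-j≡0 at₀))
            where
            at₀ : μ * (θ * 0ℤ + q) + K * c ≡ K * (∑ h - (μ * 0ℤ + c))
            at₀ = subst (λ x → μ * (θ * x + q) + K * c ≡ K * (∑ h - (μ * x + c))) h-u₀ (nbrSum-B-h u₀)
            at₁ : μ * (θ * 1ℤ + q) + K * c ≡ K * (∑ h - (μ * 1ℤ + c))
            at₁ = subst (λ x → μ * (θ * x + q) + K * c ≡ K * (∑ h - (μ * x + c))) h-u₁ (nbrSum-B-h u₁)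
            -- Subtracting the instance h = 0 of `nbrSum-B-h` from the instance h = 1 leaves the
            -- coefficient of h; the total `∑ h` cancels.
            difference : ∀ μ θ q K c s → μ * (θ + K) ≡
              (μ * (θ * 1ℤ + q) + K * c - K * (s - (μ * 1ℤ + c))) - (μ * (θ * 0ℤ + q) + K * c - K * (s - (μ * 0ℤ + c)))
            difference = solve-∀

          θ+K≡0 : θ + K ≡ 0ℤ
          θ+K≡0 = [ ⊥-elim ∘ H≢-2 θ , id ]′ (i*j≡0⇒i≡0∨j≡0 μ μ[θ+K]≡0)

          0≤h : ∀ u → 0ℤ ≤ h u
          0≤h u with h-01 u
          ... | inj₁ eq = ≤-reflexive (sym eq)
          ... | inj₂ eq = subst (0ℤ ≤_) (sym eq) (+≤+ z≤n)

          h≤1 : ∀ u → h u ≤ 1ℤ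
          h≤1 u with h-01 u
          ... | inj₁ eq = subst (_≤ 1ℤ) (sym eq) (+≤+ z≤n)
          ... | inj₂ eq = ≤-reflexive eq

          -- A vertex with h = 0 has `q` neighbours with h = 1, at most `K`; a vertex with h = 1 has
          -- `q` - `K` of them, at least 0.
          q≡K : q ≡ K
          q≡K = ≤-antisym (subst₂ _≤_ q≡ (regular u₀) (nbrSum-mono (λ w _ → h≤1 w)))
            (0≤i-j⇒j≤i (subst (0ℤ ≤_) eq (0≤nbrSum {h} {u₁} 0≤h)))
            where
            q≡ : nbrSum h u₀ ≡ q
            q≡ = trans (nbrSum-h u₀) (trans (cong (λ x → θ * x + q) h-u₀)
              (trans (cong (_+ q) (*-zeroʳ θ)) (+-identityˡ q)))
            rewriteθ : ∀ θ q K → θ * 1ℤ + q ≡ q - K + (θ + K)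
            rewriteθ = solve-∀
            eq : nbrSum h u₁ ≡ q - K
            eq = trans (nbrSum-h u₁) (trans (cong (λ x → θ * x + q) h-u₁)
              (trans (rewriteθ θ q K) (trans (cong (_+_ (q - K)) θ+K≡0) (+-identityʳ _))))

          nbrSum-h-flip : ∀ u → nbrSum h u ≡ K * (1ℤ - h u)
          nbrSum-h-flip u = trans (nbrSum-h u) (trans (regroup θ q K (h u))
            (trans (cong₂ (λ x y → x * h u + (y - K) + K * (1ℤ - h u)) θ+K≡0 q≡K) (drop K (h u))))
            where
            regroup : ∀ θ q K x → θ * x + q ≡ (θ + K) * x + (q - K) + K * (1ℤ - x)
            regroup = solve-∀
            drop : ∀ K x → 0ℤ * x + (K - K) + K * (1ℤ - x) ≡ K * (1ℤ - x)
            drop = solve-∀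

          -- If h is 1 at `u`, the neighbours' values of h sum to 0; if it is 0, their values of 1 -
          -- h do. Nonnegative terms of a zero sum vanish.
          h-flip : ∀ {u w} → Adj G u w → h w ≡ 1ℤ - h u
          h-flip {u} {w} a with h-01 u
          ... | inj₂ hu≡1 = trans (≤-antisym (subst (h w ≤_) none (term≤nbrSum 0≤h a)) (0≤h w)) (sym (cong (_-_ 1ℤ) hu≡1))
            where
            none : nbrSum h u ≡ 0ℤ
            none = trans (nbrSum-h-flip u) (trans (cong (λ x → K * (1ℤ - x)) hu≡1) (*-zeroʳ K))
          ... | inj₁ hu≡0 = trans (≤-antisym (h≤1 w)
              (0≤i-j⇒j≤i (subst (0ℤ ≤_) (negate (h w)) (neg-mono-≤ (subst (1ℤ - h w ≤_) none
                (term≤nbrSum (λ w → i≤j⇒0≤j-i (h≤1 w)) a)))))) (sym (cong (_-_ 1ℤ) hu≡0))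
            where
            negate : ∀ x → - (1ℤ - x) ≡ x - 1ℤ
            negate = solve-∀
            cancel : ∀ K → K - K * (1ℤ - 0ℤ) ≡ 0ℤ
            cancel = solve-∀
            none : nbrSum (λ w → 1ℤ - h w) u ≡ 0ℤ
            none = trans (nbrSum-- (λ _ → 1ℤ) h u) (trans (cong₂ _-_ (regular u)
              (trans (nbrSum-h-flip u) (cong (λ x → K * (1ℤ - x)) hu≡0))) (cancel K))

          h-walk : ∀ {u w ℓ} → Walk G u w ℓ → h w ≡ h u + odd ℓ * (1ℤ - (h u + h u))
          h-walk {u} [] = sym (+-identityʳ (h u))
          h-walk {u} {w} {suc ℓ} (_∷_ {v = x} a p) = trans (h-walk p)
            (trans (cong (λ y → y + odd ℓ * (1ℤ - (y + y))) (h-flip a)) (ring (h u) (odd ℓ)))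
            where
            ring : ∀ y o → 1ℤ - y + o * (1ℤ - (1ℤ - y + (1ℤ - y))) ≡ y + (1ℤ - o) * (1ℤ - (y + y))
            ring = solve-∀

        no-such-edge : ∀ {w} → ¬ Adj E u₁ w
        -- The edge `a` keeps h equal to 1, while its walk `p` has odd length d + 1 and so flips h
        -- to 0.
        no-such-edge {w} a@(p , _) = contradiction (trans (sym (trans (h-edge a) h-w)) h-u₁) λ ()
          where
          h-w : h w ≡ 0ℤ
          h-w = trans (h-walk p) (cong₂ (λ x o → x + o * (1ℤ - (x + x))) h-u₁ odd-3+e)

      no-excess-edge : ∀ {w} → ¬ Adj E u₁ w
      no-excess-edge = Eigenvalue.no-such-edge θ q (proj₁ T-h) nbrSum-h (proj₂ T-h)
        where
        θ = nbrSum h u₁ - nbrSum h u₀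
        q = nbrSum h u₀
        nbrSum-h : ∀ u → nbrSum h u ≡ θ * h u + q
        nbrSum-h = affine (nbrSum h) nbrSum-h-edge
        T-h = T-affine {h} {θ} {q} nbrSum-h (suc e)

  -- From the hypotheses to the counting conditions.

  module _ {n} (G : Graph (Fin n)) where

    degree≡nbrSum : ∀ u → Neighbours.nbrSum G (λ _ → 1ℤ) u ≡ + degree G u
    degree≡nbrSum u = trans (nbrSum-def (λ _ → 1ℤ) u)
      (trans (∑-cong λ w → *-identityʳ _) (sym (+length-filter (adj? G u) id)))
      where open Neighbours G

    -- The value `1 ℕ.+ d` lies below the cap `N`, so there the truncated distance agrees with
    -- `HasDistance`.
    degree-excessGraph : ∀ d v → let N = 2 ℕ.+ d in
      ∑ (λ w → level (1 ℕ.+ d) (Distance.dist G N (s≤s z≤n) w v)) ≡ Neighbours.nbrSum (excessGraph d G) (λ _ → 1ℤ) v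
    degree-excessGraph d v = sym (trans (nbrSum-def (λ _ → 1ℤ) v) (∑-cong λ w → trans (*-identityʳ _)
      (sym (level-𝟙 (adj? (excessGraph d G) v w)
        (λ eq → dist⇒hasDistance ℕₚ.≤-refl (trans (dist-sym v w) eq))
        (λ a → trans (dist-sym w v) (hasDistance⇒dist ℕₚ.≤-refl a))))))
      where
      open Neighbours (excessGraph d G)
      open Distance G (2 ℕ.+ d) (s≤s z≤n)

  odd-*2 : ∀ m → odd (m ℕ.* 2) ≡ 0ℤ
  odd-*2 zero    = refl
  odd-*2 (suc m) = trans (odd-suc-suc (m ℕ.* 2)) (odd-*2 m)

  +n≡excess+moore : ∀ n q i → n ⊖ mooreBound (suc q) (suc i) ≡ + 4 →
    + n ≡ H (+ suc q) i (+ suc q) + H (+ suc q) i (+ suc q) + + 4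
  +n≡excess+moore n q i eq = begin
    + n                          ≡⟨ isolate (+ n) (+ M) ⟩
    (+ n - + M) + + M            ≡⟨ cong₂ _+_ (trans ([+m]-[+n]≡m⊖n n M) eq) (cong (λ x → + (S ℕ.+ x)) (ℕₚ.+-identityʳ S)) ⟩
    + 4 + (+ S + + S)            ≡⟨ cong (λ x → + 4 + (x + x)) (sym (H≡geometricSum q i)) ⟩
    + 4 + (h + h)                ≡⟨ +-comm (+ 4) (h + h) ⟩
    h + h + + 4                  ∎
    where
    open ≡-Reasoning
    S = geometricSum q (suc i)
    M = mooreBound (suc q) (suc i)
    h = H (+ suc q) i (+ suc q)
    isolate : ∀ x y → x ≡ x - y + y
    isolate = solve-∀

  2∤⇒2∣-1 : ∀ {k} → ¬ (2 ℕᵈ.∣ k) → + 2 ∣ + k - 1ℤ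
  2∤⇒2∣-1 {k} 2∤k = [ (λ 2∣k → contradiction (∣⇒∣ᵤ 2∣k) 2∤k) , id ]′ (2∣x⊎2∣x-1 (+ k))

  -- Writing d as 2m + 4 gives `e` = 2m + 2, so the index d - 1 = 3 + 2m has the form that `H≢-2`
  -- requires.
  no-bicyclic-excess-4 : ∀ q m → 7 ℕ.≤ suc q → + 2 ∣ + suc q - 1ℤ → ∀ {n} (G : Graph (Fin n)) →
    ¬ HasBicyclicExcess4 (suc q) (suc (suc m) ℕ.* 2) G
  no-bicyclic-excess-4 q m 7≤k k-odd {n} G bi = Spectral.no-excess-edge G e K (+≤+ 7≤k)
    regular (proj₂ isKGGraph) (+n≡excess+moore n q (suc e) excess≡4) far even-e E-regular
    (twoCycles-components bicyclic) (H≢-2 {K} k-odd (m ℕ.* 2)) (TwoNeighbours.adj-s (two _))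
    where
    open HasBicyclicExcess4 bi
    e = suc (suc (m ℕ.* 2))
    K = + suc q
    E = excessGraph (2 ℕ.+ e) G
    two : ∀ v → TwoNeighbours E v
    two with bicyclic
    ... | a , b , 3≤a , 3≤b , iso = ≅-twoNeighbours iso
      (⊎ᴳ-twoNeighbours (cycle-twoNeighbours 3≤a) (cycle-twoNeighbours 3≤b))
    regular : ∀ u → Neighbours.nbrSum G (λ _ → 1ℤ) u ≡ K
    regular u = trans (degree≡nbrSum G u) (cong +_ (proj₁ isKGGraph u))
    E-regular : ∀ u → Neighbours.nbrSum E (λ _ → 1ℤ) u ≡ + 2
    E-regular u = twoNeighbours⇒degree-2 E (two u)
    far = λ v → trans (degree-excessGraph G (2 ℕ.+ e) v) (E-regular v)
    even-e : odd e ≡ 0ℤ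
    even-e = odd-*2 (suc m)

open import Data.Nat using (ℕ; _*_; _≤_)
open import Data.Nat.Divisibility using (_∣_)

theorem3p4 : (k d : ℕ) → 7 ≤ k → ¬ (2 ∣ k) → 8 ≤ 2 * d → 2 ∣ d →
    ¬ (∃[ n ] Σ (Graph (Fin n)) λ G → HasBicyclicExcess4 k d G)
theorem3p4 (ℕ.suc q) _ 7≤k 2∤k 8≤2d (ℕᵈ.divides (ℕ.suc (ℕ.suc m)) refl) (_ , G , bi) =
  Excess.no-bicyclic-excess-4 q m 7≤k (Excess.2∤⇒2∣-1 2∤k) G bi
-- The remaining even values of d are 2 and 0, for which 2d is below 8.
theorem3p4 _ _ _ _ (ℕ.s≤s (ℕ.s≤s (ℕ.s≤s (ℕ.s≤s ())))) (ℕᵈ.divides 1 refl) _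
theorem3p4 _ _ _ _ () (ℕᵈ.divides 0 refl) _
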